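{- The problem $k$-SEPARATING VERTICES restricted to co-balanced 3-track interval graphs (complements of balanced 3-track interval graphs) is W[1]-hard with parameters $k$ and $l$.
   Context: $k$-SEPARATING VERTICES: given a graph $H=(V,E)$ and two integers $k$ and $l$, decide whether there is a partition $V=X\cup S\cup Y$ of the vertices such that $|X|=l$, $|S|\le k$, and there is no edge between $X$ and $Y$. "With parameters $k$ and $l$" means that the pair $(k,l)$ is the parameter. The intersection graph of a family of sets has one vertex per member, two different members being adjacent iff they intersect; the family is a representation of the graph. A 3-track interval is the union of three intervals on three disjoint parallel lines (tracks), one interval on each track. A balanced 3-track interval graph is the intersection graph of a family of 3-track intervals in which the three intervals of each 3-track interval have the same length (intervals from different 3-track intervals may have different lengths). Such a representation of the complement of $H$ is given as part of the input. A parameterized problem is W[1]-hard if every problem in W[1] has an FPT reduction to it; equivalently, if $k$-CLIQUE in general graphs (parameter $k$) has an FPT reduction to it. An FPT reduction maps an instance $x$ with parameter $\kappa$ to an equivalent instance $x'$ with parameter $\kappa'$ in time $g(\kappa)\cdot|x|^{O(1)}$, with $\kappa'$ bounded by a function of $\kappa$ (all functions computable). -}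

module Defs where

open import Data.Bool using (Bool; true; false; T; not; _∧_)
open import Data.Bool.Properties using (∧-zeroʳ)
open import Data.Empty using (⊥-elim)
open import Data.Fin using (Fin; _≟_)
open import Data.Fin.Subset as Subset using (Subset; ∣_∣; _∪_; _∩_)
open import Data.Integer as ℤ using (ℤ)
open import Data.List as List using (List; []; _∷_)
open import Data.Nat using (ℕ; suc; _+_; _*_; _^_; _≤_)
open import Data.Nat.Binary as ℕᵇ using (ℕᵇ; 2[1+_]; 1+[2_])
open import Data.Product using (Σ; ∃; _×_; _,_)
open import Data.Rational as ℚ using (ℚ; ↥_; ↧ₙ_)
open import Data.Sign using (Sign)
open import Data.Vec as Vec using (Vec; []; _∷_; lookup; _[_]≔_)
open import Data.Vec.Relation.Unary.All using (All)
open import Function.Bundles using (_⇔_)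
open import Level using (0ℓ)
open import Relation.Binary.PropositionalEquality
  using (_≡_; _≢_; refl; sym; cong₂)
open import Relation.Nullary using (¬_; yes; no)
open import Relation.Nullary.Decidable using (⌊_⌋)
open import Relation.Unary using (Pred; _≬_)

-- The model of computation is the WHILE language on binary trees
-- (N. D. Jones, Computability and Complexity, 1997).

data Tree : Set where
  nil : Tree
  _∙_ : Tree → Tree → Tree

infixr 5 _∙_

size : Tree → ℕ
size nil     = 1
size (s ∙ t) = suc (size s + size t)

head tail : Tree → Tree
head nil     = nil
head (s ∙ _) = s
tail nil     = nil
tail (_ ∙ t) = t

data Expr (m : ℕ) : Set where
  var   : Fin m → Expr m
  nil   : Expr m
  cons  : Expr m → Expr m → Expr m
  hd tl : Expr m → Expr m

infix  6 _:=_
infixr 5 _⨟_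

data Cmd (m : ℕ) : Set where
  _:=_          : Fin m → Expr m → Cmd m
  _⨟_           : Cmd m → Cmd m → Cmd m
  if_then_else_ : Expr m → Cmd m → Cmd m → Cmd m
  while_run_    : Expr m → Cmd m → Cmd m

Store : ℕ → Set
Store m = Vec Tree m

eval : ∀ {m} → Store m → Expr m → Tree
eval σ (var x)    = lookup σ x
eval σ nil        = nil
eval σ (cons d e) = eval σ d ∙ eval σ e
eval σ (hd e)     = head (eval σ e)
eval σ (tl e)     = tail (eval σ e)

-- Exec c σ τ s: started in σ, the command c halts in τ after s steps.
-- Tests read nil as false and every other tree as true.  Evaluating an
-- expression counts as one step: it takes a number of operations on cons
-- cells that depends on the program only.
data Exec {m : ℕ} : Cmd m → Store m → Store m → ℕ → Set where
  assign : ∀ {x e σ} → Exec (x := e) σ (σ [ x ]≔ eval σ e) 1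
  seq    : ∀ {c d σ τ υ s t} →
           Exec c σ τ s → Exec d τ υ t → Exec (c ⨟ d) σ υ (s + t)
  if-t   : ∀ {e c d σ τ s} → eval σ e ≢ nil →
           Exec c σ τ s → Exec (if e then c else d) σ τ (suc s)
  if-f   : ∀ {e c d σ τ s} → eval σ e ≡ nil →
           Exec d σ τ s → Exec (if e then c else d) σ τ (suc s)
  loop   : ∀ {e c σ τ υ s t} → eval σ e ≢ nil →
           Exec c σ τ s → Exec (while e run c) τ υ t →
           Exec (while e run c) σ υ (suc (s + t))
  exit   : ∀ {e c σ} → eval σ e ≡ nil →
           Exec (while e run c) σ σ 1

-- Variable 0 holds the input at the start and the output at the end; all
-- other variables start as nil.
record Program : Set where
  field
    extra : ℕ
    body  : Cmd (suc extra)

open Program public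

-- The running time includes writing out the output.  Cons cells are shared
-- in memory, so without this charge the output could be exponentially
-- larger than the number of steps.  With it, the model and multitape Turing
-- machines simulate each other with polynomial overhead.
record Computes (p : Program) (x y : Tree) (time : ℕ) : Set where
  field
    final   : Store (suc (extra p))
    steps   : ℕ
    exec    : Exec (body p) (x ∷ Vec.replicate (extra p) nil) final steps
    output  : Vec.head final ≡ y
    elapsed : time ≡ steps + size y

encodeBool : Bool → Tree
encodeBool false = nil
encodeBool true  = nil ∙ nil

-- Numbers are written in (bijective) binary, least significant digit first.
encodeℕᵇ : ℕᵇ → Tree
encodeℕᵇ ℕᵇ.zero  = nil
encodeℕᵇ 2[1+ n ] = encodeBool false ∙ encodeℕᵇ n
encodeℕᵇ 1+[2 n ] = encodeBool true ∙ encodeℕᵇ n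

encodeℕ : ℕ → Tree
encodeℕ n = encodeℕᵇ (ℕᵇ.fromℕ n)

encodeSign : Sign → Tree
encodeSign Sign.+ = encodeBool false
encodeSign Sign.- = encodeBool true

encodeℤ : ℤ → Tree
encodeℤ i = encodeSign (ℤ.sign i) ∙ encodeℕ ℤ.∣ i ∣

encodeℚ : ℚ → Tree
encodeℚ q = encodeℤ (↥ q) ∙ encodeℕ (↧ₙ q)

encodeList : ∀ {A : Set} → (A → Tree) → List A → Tree
encodeList enc []       = nil
encodeList enc (x ∷ xs) = enc x ∙ encodeList enc xs

encodeFamily : ∀ {A : Set} {n} → (A → Tree) → (Fin n → A) → Tree
encodeFamily enc f = encodeList enc (List.tabulate f)

encodeParams : ∀ {d} → Vec ℕ d → Tree
encodeParams v = encodeList encodeℕ (Vec.toList v)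

-- A problem restricted to a class of inputs has only the inputs of that
-- class as instances.  The parameter is a tuple of numbers.
record ParamProblem : Set₁ where
  field
    Instance : Set
    encode   : Instance → Tree
    arity    : ℕ
    param    : Instance → Vec ℕ arity
    Yes      : Instance → Set

Computable : ∀ {d} → (Vec ℕ d → ℕ) → Set
Computable f =
  ∃ λ p → ∀ v → ∃ λ t → Computes p (encodeParams v) (encodeℕ (f v)) t

record FPTReduction (P Q : ParamProblem) : Set where
  private
    module P = ParamProblem P
    module Q = ParamProblem Q
  field
    program      : Program
    g            : Vec ℕ P.arity → ℕ
    g-computable : Computable g
    exponent     : ℕ
    h            : Vec ℕ P.arity → ℕ
    h-computable : Computable h
    image        : P.Instance → Q.Instance
    time         : P.Instance → ℕ
    computes     : ∀ x →
      Computes program (P.encode x) (Q.encode (image x)) (time x)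
    time-bound   : ∀ x →
      time x ≤ g (P.param x) * size (P.encode x) ^ exponent
    equivalent   : ∀ x → P.Yes x ⇔ Q.Yes (image x)
    param-bound  : ∀ x → All (_≤ h (P.param x)) (Q.param (image x))

record Graph (n : ℕ) : Set where
  field
    edge        : Fin n → Fin n → Bool
    symmetric   : ∀ u v → edge u v ≡ edge v u
    irreflexive : ∀ v → edge v v ≡ false

  Adjacent : Fin n → Fin n → Set
  Adjacent u v = T (edge u v)

open Graph public

private
  ≟-sym : ∀ {n} (u v : Fin n) → ⌊ u ≟ v ⌋ ≡ ⌊ v ≟ u ⌋
  ≟-sym u v with u ≟ v | v ≟ u
  ... | yes _ | yes _ = refl
  ... | no  _ | no  _ = refl
  ... | yes p | no ¬q = ⊥-elim (¬q (sym p))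
  ... | no ¬p | yes q = ⊥-elim (¬p (sym q))

  ≟-refl : ∀ {n} (v : Fin n) → ⌊ v ≟ v ⌋ ≡ true
  ≟-refl v with v ≟ v
  ... | yes _ = refl
  ... | no ¬p = ⊥-elim (¬p refl)

complement : ∀ {n} → Graph n → Graph n
complement G .edge u v = not (edge G u v) ∧ not ⌊ u ≟ v ⌋
complement G .symmetric u v =
  cong₂ (λ a b → not a ∧ not b) (symmetric G u v) (≟-sym u v)
complement G .irreflexive v
  rewrite ≟-refl v = ∧-zeroʳ (not (edge G v v))

encodeGraph : ∀ {n} → Graph n → Tree
encodeGraph G = encodeFamily (encodeFamily encodeBool) (edge G)

IsIntersectionGraph : ∀ {n} {A : Set} → (Fin n → Pred A 0ℓ) → Graph n → Set
IsIntersectionGraph F G = ∀ u v → Adjacent G u v ⇔ (u ≢ v × F u ≬ F v)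

-- Nonempty closed intervals.  Endpoints are rational so that they can be
-- part of an input; a finite balanced family with real endpoints has the
-- same intersection graph as some balanced family with rational ones.
record Interval : Set where
  field
    left right : ℚ
    left≤right : left ℚ.≤ right

  length : ℚ
  length = right ℚ.- left

open Interval public

3-TrackInterval : Set
3-TrackInterval = Fin 3 → Interval

-- The point (i , q) is the point q of track i.
points : 3-TrackInterval → Pred (Fin 3 × ℚ) 0ℓ
points J (i , q) = left (J i) ℚ.≤ q × q ℚ.≤ right (J i)

Balanced : 3-TrackInterval → Set
Balanced J = ∀ i j → length (J i) ≡ length (J j)

record Balanced3TrackRepresentation {n : ℕ} (G : Graph n) : Set where
  field
    family     : Fin n → 3-TrackInterval
    balanced   : ∀ v → Balanced (family v)
    represents : IsIntersectionGraph (λ v → points (family v)) G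

encodeInterval : Interval → Tree
encodeInterval I = encodeℚ (left I) ∙ encodeℚ (right I)

encodeRepresentation : ∀ {n} {G : Graph n} →
                       Balanced3TrackRepresentation G → Tree
encodeRepresentation R =
  encodeFamily (encodeFamily encodeInterval)
               (Balanced3TrackRepresentation.family R)

HasClique : ∀ {n} → Graph n → ℕ → Set
HasClique {n} G k = Σ (Subset n) λ C →
  ∣ C ∣ ≡ k ×
  (∀ u v → u Subset.∈ C → v Subset.∈ C → u ≢ v → Adjacent G u v)

k-Clique : ParamProblem
k-Clique = record
  { Instance = ∃ λ n → Graph n × ℕ
  ; encode   = λ (_ , G , k) → encodeGraph G ∙ encodeℕ k
  ; arity    = 1
  ; param    = λ (_ , _ , k) → k ∷ []
  ; Yes      = λ (_ , G , k) → HasClique G k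
  }

-- k-Clique is complete for W[1], so this says that every problem in W[1]
-- has an FPT reduction to Q.
W[1]-Hard : ParamProblem → Set
W[1]-Hard Q = FPTReduction k-Clique Q

record Separation {n : ℕ} (H : Graph n) (k l : ℕ) : Set where
  field
    X S Y   : Subset n
    cover   : X ∪ S ∪ Y ≡ Subset.⊤
    X∩S     : X ∩ S ≡ Subset.⊥
    X∩Y     : X ∩ Y ≡ Subset.⊥
    S∩Y     : S ∩ Y ≡ Subset.⊥
    ∣X∣≡l   : ∣ X ∣ ≡ l
    ∣S∣≤k   : ∣ S ∣ ≤ k
    no-edge : ∀ u v → u Subset.∈ X → v Subset.∈ Y → ¬ Adjacent H u v

record SeparatingVerticesInstance : Set where
  field
    {n}            : ℕ
    H              : Graph n
    representation : Balanced3TrackRepresentation (complement H)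
    k l            : ℕ

k-SeparatingVertices-CoBalanced3Track : ParamProblem
k-SeparatingVertices-CoBalanced3Track = record
  { Instance = SeparatingVerticesInstance
  ; encode   = λ x → encodeGraph (H x) ∙ encodeRepresentation (representation x)
                       ∙ encodeℕ (k x) ∙ encodeℕ (l x)
  ; arity    = 2
  ; param    = λ x → k x ∷ l x ∷ []
  ; Yes      = λ x → Separation (H x) (k x) (l x)
  }
  where open SeparatingVerticesInstance

{-# OPTIONS --safe #-}
module Submission where

-- For a graph G on n vertices, H has a clique of "points", namely the vertices
-- of G, the ordered pairs (i , j) that are neither adjacent nor equal, and
-- (1 + k)² dummies. Each remaining ordered pair (i , j) is joined in H to the
-- points i and j only. A clique C of size k separates the k² pairs over C by
-- the k points of C. Conversely, let l = k² vertices X be cut off by k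
-- vertices S. X contains no point, since otherwise all points, more than
-- k² + k, would lie in X ∪ S. So X consists of pairs, with all endpoints in S;
-- as |X| = k², it consists of all pairs over k vertices, which form a clique.
--
-- In the complement of H the points are disjoint and the pairs intersect each
-- other. With a = min i j and b = max i j, the three tracks of the pair (i , j)
-- cover the points below a, those strictly between a and b, and those above b.
-- The length is dictated by the second track, where points are 2 + N apart,
-- while the unit spacing on the other two makes this length always sufficient.
--
-- The reduction is polynomial in the input and the value of k: functions that
-- are polynomial in running time and output size are closed under composition,
-- conditionals, and folds whose accumulators stay polynomially bounded.

open import Data.Bool using (Bool; true; false; T; _∨_; not)
  renaming (if_then_else_ to ifᵇ_then_else_)
open import Data.Bool.Properties using (T-∨; T-∧; T-≡)
open import Data.Empty using (⊥-elim)
open import Data.Fin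
  using (Fin; zero; suc; toℕ; _↑ˡ_; _↑ʳ_; combine; splitAt; _≟_)
open import Data.Fin.Properties
  using (toℕ-injective; toℕ-↑ˡ; toℕ<n; splitAt⁻¹-↑ˡ; splitAt⁻¹-↑ʳ; combine-surjective)
open import Data.Fin.Subset as Subset using (Subset; ∣_∣; _∈_; _∉_; _⊆_; _∪_; _∩_; ∁)
open import Data.Fin.Subset.Properties
  using (p⊆q⇒∣p∣≤∣q∣; p⊂q⇒∣p∣<∣q∣; _∈?_; Empty-unique; x∈p∩q⁻; x∈p∪q⁻; x∈p∪q⁺;
         p∪∁p≡⊤; ∪-assoc; x∈∁p⇒x∉p; ∉⊥; ∈⊤; ∣⊥∣≡0; ∣⊤∣≡n)
import Data.Integer as ℤ
import Data.Integer.Properties as ℤ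
open import Data.List as List using (List; []; _∷_; _++_; foldr; _ʳ++_)
open import Data.List.Properties
  using (ʳ++-defn; ʳ++-ʳ++; length-reverse; length-replicate; length-++; length-tabulate;
         ++-assoc; ++-identityʳ; map-tabulate; tabulate-cong)
open import Data.Nat
  using (ℕ; zero; suc; pred; _+_; _*_; _^_; _∸_; _⊓_; _⊔_; _≤_; _<_; _≡ᵇ_; z≤n; s≤s; s≤s⁻¹)
open import Data.Nat.Binary as ℕᵇ using (ℕᵇ; 2[1+_]; 1+[2_])
open import Data.Nat.Binary.Properties using (toℕ-fromℕ; fromℕ≡fromℕ')
import Data.Nat.Coprimality as Coprimality
open import Data.Nat.GeneralisedArithmetic using (fold)
open import Data.Nat.Properties hiding (_≟_)
open import Data.Nat.Tactic.RingSolver using (solve-∀)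
open import Data.Product using (∃; ∃₂; _×_; _,_; proj₁; proj₂)
open import Data.Rational as ℚ using (ℚ; mkℚ)
import Data.Rational.Properties as ℚ
import Data.Rational.Unnormalised as ℚᵘ
import Data.Rational.Unnormalised.Properties as ℚᵘ
open import Data.Sum as Sum using (_⊎_; inj₁; inj₂)
open import Data.Unit using (⊤; tt)
open import Data.Vec as Vec
  using (Vec; []; _∷_; _[_]≔_; lookup; concat; replicate; tabulate; take; drop)
  renaming (_++_ to _++ᵛ_)
open import Data.Vec.Properties
  using (lookup-++ˡ; lookup-++ʳ; lookup-concat; lookup∘tabulate; lookup-replicate; lookup-map;
         take++drop≡id; []=⇒lookup; lookup⇒[]=; toList-++; toList-replicate)
open import Data.Vec.Relation.Unary.All using ([]; _∷_)
open import Function using (_∘_)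
open import Function.Bundles using (_⇔_; mk⇔; Equivalence)
open import Relation.Binary.Definitions using (tri<; tri≈; tri>)
open import Relation.Binary.PropositionalEquality
  using (_≡_; _≢_; _≗_; refl; sym; trans; cong; cong₂; subst; subst₂; module ≡-Reasoning)
open import Relation.Nullary using (¬_; yes; no)
open import Relation.Nullary.Decidable using (fromWitness; toWitness)
open import Relation.Unary using (_≬_)

open import Defs

-- Data types, their encodings and measures

unary : ℕ → Tree
unary zero    = nil
unary (suc n) = nil ∙ unary n

size-unary : ∀ n → size (unary n) ≡ suc (2 * n)
size-unary zero    = refl
size-unary (suc n) = cong (λ m → suc (suc m)) (trans (size-unary n) (sym (+-suc n (n + 0))))

-- Each digit adds at most 4 nodes to the tree and at least 1 to the value.
size-encodeℕᵇ : ∀ x → size (encodeℕᵇ x) ≤ suc (4 * ℕᵇ.toℕ x)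
size-encodeℕᵇ ℕᵇ.zero  = ≤-refl
size-encodeℕᵇ 2[1+ x ] = begin
  2 + size (encodeℕᵇ x)     ≤⟨ +-monoʳ-≤ 2 (size-encodeℕᵇ x) ⟩
  3 + 4 * t                 ≤⟨ m≤m+n _ (6 + 4 * t) ⟩
  3 + 4 * t + (6 + 4 * t)   ≡⟨ even t ⟩
  suc (4 * (2 * suc t))     ∎
  where
  open ≤-Reasoning
  t = ℕᵇ.toℕ x
  even : ∀ t → 3 + 4 * t + (6 + 4 * t) ≡ suc (4 * (2 * suc t))
  even = solve-∀
size-encodeℕᵇ 1+[2 x ] = begin
  4 + size (encodeℕᵇ x)     ≤⟨ +-monoʳ-≤ 4 (size-encodeℕᵇ x) ⟩
  5 + 4 * t                 ≤⟨ m≤m+n _ (4 * t) ⟩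
  5 + 4 * t + 4 * t         ≡⟨ odd t ⟩
  suc (4 * suc (2 * t))     ∎
  where
  open ≤-Reasoning
  t = ℕᵇ.toℕ x
  odd : ∀ t → 5 + 4 * t + 4 * t ≡ suc (4 * suc (2 * t))
  odd = solve-∀

infixr 2 _×ᴰ_

-- Codes for the types of data that programs work on; unᴰ and binᴰ are numbers
-- in unary and in binary, and ratᴰ is a natural number written as a rational.
data Data : Set where
  unitᴰ boolᴰ unᴰ binᴰ ratᴰ : Data
  _×ᴰ_  : Data → Data → Data
  listᴰ : Data → Data

Carrier : Data → Set
Carrier unitᴰ     = ⊤
Carrier boolᴰ     = Bool
Carrier unᴰ       = ℕ
Carrier binᴰ      = ℕ
Carrier ratᴰ      = ℕ
Carrier (A ×ᴰ B)  = Carrier A × Carrier B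
Carrier (listᴰ A) = List (Carrier A)

enc : ∀ A → Carrier A → Tree
enc unitᴰ     _       = nil
enc boolᴰ     b       = encodeBool b
enc unᴰ       n       = unary n
enc binᴰ      n       = encodeℕ n
enc ratᴰ      n       = (nil ∙ encodeℕ n) ∙ encodeℕ 1
enc (A ×ᴰ B)  (a , b) = enc A a ∙ enc B b
enc (listᴰ A) xs      = encodeList (enc A) xs

-- An upper bound on the size of the representation. For numbers in binary it
-- is linear in the value, which makes decoding to unary a polynomial operation.
μ : ∀ A → Carrier A → ℕ
μ unitᴰ     _        = 1
μ boolᴰ     b        = size (encodeBool b)
μ unᴰ       n        = suc (2 * n)
μ binᴰ      n        = suc (4 * n)
μ ratᴰ      n        = 9 + 4 * n
μ (A ×ᴰ B)  (a , b)  = suc (μ A a + μ B b)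
μ (listᴰ A) []       = 1
μ (listᴰ A) (x ∷ xs) = suc (μ A x + μ (listᴰ A) xs)

size-encodeℕ : ∀ n → size (encodeℕ n) ≤ suc (4 * n)
size-encodeℕ n = subst (λ m → size (encodeℕ n) ≤ suc (4 * m)) (toℕ-fromℕ n)
                       (size-encodeℕᵇ (ℕᵇ.fromℕ n))

size≤μ : ∀ A a → size (enc A a) ≤ μ A a
size≤μ unitᴰ     _        = ≤-refl
size≤μ boolᴰ     _        = ≤-refl
size≤μ unᴰ       n        = ≤-reflexive (size-unary n)
size≤μ binᴰ      n        = size-encodeℕ n
size≤μ ratᴰ      n        = s≤s (s≤s (s≤s (begin
  size (encodeℕ n) + 5 ≤⟨ +-monoˡ-≤ 5 (size-encodeℕ n) ⟩
  suc (4 * n) + 5      ≡⟨ +-comm (suc (4 * n)) 5 ⟩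
  6 + 4 * n            ∎)))
  where open ≤-Reasoning
size≤μ (A ×ᴰ B)  (a , b)  = s≤s (+-mono-≤ (size≤μ A a) (size≤μ B b))
size≤μ (listᴰ A) []       = ≤-refl
size≤μ (listᴰ A) (x ∷ xs) = s≤s (+-mono-≤ (size≤μ A x) (size≤μ (listᴰ A) xs))

1≤size : ∀ t → 1 ≤ size t
1≤size nil     = ≤-refl
1≤size (_ ∙ _) = s≤s z≤n

1≤μ : ∀ A a → 1 ≤ μ A a
1≤μ A a = ≤-trans (1≤size (enc A a)) (size≤μ A a)

-- Polynomially bounded functions

-- A single power suffices in place of a polynomial: its base is at least 2, so constants are
-- bounded by powers of it, and a sum costs one more degree.
record Poly (A : Data) (b : Carrier A → ℕ) : Set where
  constructor _,_
  field
    degree : ℕ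
    bound  : ∀ a → b a ≤ suc (μ A a) ^ degree

open Poly

n≤2^n : ∀ n → n ≤ 2 ^ n
n≤2^n zero    = z≤n
n≤2^n (suc n) = begin
  1 + n         ≤⟨ +-mono-≤ (m^n>0 2 n) (n≤2^n n) ⟩
  2 ^ n + 2 ^ n ≡⟨ cong (2 ^ n +_) (sym (+-identityʳ _)) ⟩
  2 ^ suc n     ∎
  where open ≤-Reasoning

module _ {A : Data} where

  poly-≤ : ∀ {b c} → (∀ a → b a ≤ c a) → Poly A c → Poly A b
  poly-≤ b≤c (d , p) = d , λ a → ≤-trans (b≤c a) (p a)

  poly-const : ∀ c → Poly A (λ _ → c)
  poly-const c = c , λ a → ≤-trans (n≤2^n c) (^-monoˡ-≤ c (s≤s (1≤μ A a)))

  poly-μ : Poly A (μ A)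
  poly-μ = 1 , λ a → ≤-trans (n≤1+n _) (≤-reflexive (sym (*-identityʳ _)))

  poly-* : ∀ {b c} → Poly A b → Poly A c → Poly A (λ a → b a * c a)
  poly-* (d , p) (e , q) = d + e , λ a → ≤-trans (*-mono-≤ (p a) (q a))
    (≤-reflexive (sym (^-distribˡ-+-* (suc (μ A a)) d e)))

  poly-^ : ∀ {b} e → Poly A b → Poly A (λ a → b a ^ e)
  poly-^ e (d , p) = d * e , λ a → ≤-trans (^-monoˡ-≤ e (p a))
    (≤-reflexive (^-*-assoc (suc (μ A a)) d e))

  poly-+ : ∀ {b c} → Poly A b → Poly A c → Poly A (λ a → b a + c a)
  poly-+ {b} {c} (d , p) (e , q) = suc (d + e) , b+c≤
    where
    open ≤-Reasoning
    b+c≤ : ∀ a → b a + c a ≤ suc (μ A a) ^ suc (d + e)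
    b+c≤ a = begin
      b a + c a                 ≤⟨ +-mono-≤ (p a) (q a) ⟩
      m ^ d + m ^ e             ≤⟨ +-mono-≤ (^-monoʳ-≤ m (m≤m+n d e)) (^-monoʳ-≤ m (m≤n+m e d)) ⟩
      m ^ (d + e) + m ^ (d + e) ≡⟨ cong (m ^ (d + e) +_) (sym (+-identityʳ _)) ⟩
      2 * m ^ (d + e)           ≤⟨ *-monoˡ-≤ (m ^ (d + e)) (s≤s (1≤μ A a)) ⟩
      m ^ suc (d + e)           ∎
      where m = suc (μ A a)

  poly-suc : ∀ {b} → Poly A b → Poly A (λ a → suc (b a))
  poly-suc = poly-+ (poly-const 1)

-- Since `b` is measured at `f a`, a bound on the output of `f` is what keeps the composition
-- polynomial.
poly-∘ : ∀ {A B b} {f : Carrier A → Carrier B} →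
         Poly B b → Poly A (μ B ∘ f) → Poly A (b ∘ f)
poly-∘ {A} (d , p) q =
  poly-≤ (λ a → p _) (poly-^ d (poly-suc q))

-- Programs for polynomial-time functions

Within : Cmd 2 → Store 2 → Store 2 → ℕ → Set
Within c σ τ b = ∃ λ t → Exec c σ τ t × t ≤ b

infixr 5 _⨾_

_⨾_ : ∀ {c d σ τ υ a b} →
      Within c σ τ a → Within d τ υ b → Within (c ⨟ d) σ υ (a + b)
(_ , p , s≤a) ⨾ (_ , q , t≤b) = _ , seq p q , +-mono-≤ s≤a t≤b

assigned : ∀ {x e σ} → Within (x := e) σ (σ [ x ]≔ eval σ e) 1
assigned = _ , assign , ≤-refl

-- Variable 0 holds a value and variable 1 a stack, which a realizer leaves as
-- it found it; so two variables suffice for all programs.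
record Real (A B : Data) (f : Carrier A → Carrier B) : Set where
  field
    cmd       : Cmd 2
    cost      : Carrier A → ℕ
    run       : ∀ a s → Within cmd (enc A a ∷ s ∷ []) (enc B (f a) ∷ s ∷ []) (cost a)
    cost-poly : Poly A cost
    growth    : Poly A (μ B ∘ f)

open Real

pattern val = var zero
pattern stk = var (suc zero)

module _ {A B : Data} where

  castR : ∀ {f g : Carrier A → Carrier B} → f ≗ g → Real A B f → Real A B g
  castR f≗g r = record
    { cmd       = cmd r
    ; cost      = cost r
    ; run       = λ a s → subst (λ y → Within _ _ (enc B y ∷ _) _) (f≗g a) (run r a s)
    ; cost-poly = cost-poly r
    ; growth    = poly-≤ (λ a → ≤-reflexive (cong (μ B) (sym (f≗g a)))) (growth r)
    }

  exprR : ∀ {f : Carrier A → Carrier B} (e : Expr 2) →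
          (∀ a s → eval (enc A a ∷ s ∷ []) e ≡ enc B (f a)) →
          Poly A (μ B ∘ f) → Real A B f
  exprR e eq g = record
    { cmd       = zero := e
    ; cost      = λ _ → 1
    ; run       = λ a s → subst (λ y → Within (zero := e) _ (y ∷ _) _) (eq a s) assigned
    ; cost-poly = poly-const 1
    ; growth    = g
    }

module _ {A B C : Data} where

  infixr 9 _∘R_

  _∘R_ : ∀ {g f} → Real B C g → Real A B f → Real A C (g ∘ f)
  q ∘R p = record
    { cmd       = cmd p ⨟ cmd q
    ; cost      = λ a → cost p a + cost q _
    ; run       = λ a s → run p a s ⨾ run q _ s
    ; cost-poly = poly-+ (cost-poly p) (poly-∘ {A} {B} (cost-poly q) (growth p))
    ; growth    = poly-∘ {A} {B} (growth q) (growth p)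
    }

idR : ∀ {A} → Real A A (λ a → a)
idR = exprR val (λ _ _ → refl) poly-μ

module _ {A B : Data} where

  fstR : Real (A ×ᴰ B) A proj₁
  fstR = exprR (hd val) (λ _ _ → refl)
    (poly-≤ (λ (a , b) → m≤n⇒m≤1+n (m≤m+n (μ A a) (μ B b))) poly-μ)

  sndR : Real (A ×ᴰ B) B proj₂
  sndR = exprR (tl val) (λ _ _ → refl)
    (poly-≤ (λ (a , b) → m≤n⇒m≤1+n (m≤n+m (μ B b) (μ A a))) poly-μ)

module _ {Γ A B : Data} where

  pairR : ∀ {f g} → Real Γ A f → Real Γ B g → Real Γ (A ×ᴰ B) (λ γ → f γ , g γ)
  pairR p q = record
    { cmd = suc zero := cons val stk ⨟ cmd p
          -- The result of `p` goes under the saved input, which then returns to variable 0 for `q`.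
          ⨟ suc zero := cons (hd stk) (cons val (tl stk))
          ⨟ zero := hd stk ⨟ suc zero := tl stk ⨟ cmd q
          ⨟ zero := cons (hd stk) val ⨟ suc zero := tl stk
    ; cost = λ γ → 1 + (cost p γ + (3 + (cost q γ + 2)))
    ; run = λ γ s → assigned ⨾ run p γ _ ⨾ assigned ⨾ assigned ⨾ assigned
                  ⨾ run q γ _ ⨾ assigned ⨾ assigned
    ; cost-poly = poly-suc (poly-+ (cost-poly p)
        (poly-+ (poly-const 3) (poly-+ (cost-poly q) (poly-const 2))))
    ; growth = poly-suc (poly-+ (growth p) (growth q))
    }

module _ {Γ A B C : Data} where

  ap₂ : ∀ {h f g} → Real (A ×ᴰ B) C h → Real Γ A f → Real Γ B g →
        Real Γ C (λ γ → h (f γ , g γ))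
  ap₂ r p q = r ∘R pairR p q

module _ {Γ A B : Data} where

  letR : ∀ {f g} → Real Γ A f → Real (Γ ×ᴰ A) B g → Real Γ B (λ γ → g (γ , f γ))
  letR p r = r ∘R pairR idR p

module _ {Γ A : Data} where

  ifR : ∀ {b f g} → Real Γ boolᴰ b → Real Γ A f → Real Γ A g →
        Real Γ A (λ γ → ifᵇ b γ then f γ else g γ)
  ifR {b} {f} {g} r p q = record
    { cmd = suc zero := cons val stk ⨟ cmd r
          ⨟ if val then c₁ else c₂
    -- The costs of both branches are added, so that the bound does not depend on the outcome of the
    -- test.
    ; cost = λ γ → 1 + (cost r γ + suc (2 + (cost p γ + cost q γ)))
    ; run = λ γ s → assigned ⨾ run r γ _ ⨾ branch (b γ) γ s
    ; cost-poly = poly-suc (poly-+ (cost-poly r) (poly-suc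
        (poly-+ (poly-const 2) (poly-+ (cost-poly p) (cost-poly q)))))
    ; growth = poly-≤ (λ γ → choice (b γ) γ) (poly-+ (growth p) (growth q))
    }
    where
    c₁ c₂ : Cmd 2
    c₁ = zero := hd stk ⨟ suc zero := tl stk ⨟ cmd p
    c₂ = zero := hd stk ⨟ suc zero := tl stk ⨟ cmd q

    branch : ∀ v γ s → Within (if val then c₁ else c₂)
      (encodeBool v ∷ (enc Γ γ ∙ s) ∷ []) (enc A (ifᵇ v then f γ else g γ) ∷ s ∷ [])
      (suc (2 + (cost p γ + cost q γ)))
    branch true γ s with assigned ⨾ assigned ⨾ run p γ s
    ... | _ , e , t≤ = _ , if-t (λ ()) e
      , s≤s (≤-trans t≤ (+-monoʳ-≤ 2 (m≤m+n (cost p γ) (cost q γ))))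
    branch false γ s with assigned ⨾ assigned ⨾ run q γ s
    ... | _ , e , t≤ = _ , if-f refl e
      , s≤s (≤-trans t≤ (+-monoʳ-≤ 2 (m≤n+m (cost q γ) (cost p γ))))

    choice : ∀ v γ → μ A (ifᵇ v then f γ else g γ) ≤ μ A (f γ) + μ A (g γ)
    choice true  γ = m≤m+n _ _
    choice false γ = m≤n+m _ _

-- Folds over lists

module _ {A : Data} where

  length≤μ : ∀ xs → List.length xs ≤ μ (listᴰ A) xs
  length≤μ []       = z≤n
  length≤μ (x ∷ xs) = s≤s (≤-trans (length≤μ xs) (m≤n+m _ (μ A x)))

  μ-member : ∀ us x vs → μ A x ≤ μ (listᴰ A) (us ++ x ∷ vs)
  μ-member []       x vs = m≤n⇒m≤1+n (m≤m+n _ _)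
  μ-member (u ∷ us) x vs = m≤n⇒m≤1+n (≤-trans (μ-member us x vs) (m≤n+m _ (μ A u)))

  μ-suffix : ∀ us vs → μ (listᴰ A) vs ≤ μ (listᴰ A) (us ++ vs)
  μ-suffix []       vs = ≤-refl
  μ-suffix (u ∷ us) vs = m≤n⇒m≤1+n (≤-trans (μ-suffix us vs) (m≤n+m _ (μ A u)))

-- The list is first reversed, since a while loop consumes it from the front.
module Fold {Γ A B : Data}
  {xs : Carrier Γ → List (Carrier A)} {z : Carrier Γ → Carrier B}
  {f : (Carrier Γ × Carrier A) × Carrier B → Carrier B}
  (xsR : Real Γ (listᴰ A) xs) (zR : Real Γ B z) (fR : Real ((Γ ×ᴰ A) ×ᴰ B) B f)
  -- Iterating a function of polynomial growth can produce values of exponential size. Hence every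
  -- intermediate accumulator, the fold over a suffix `vs`, must obey a polynomial bound `g`.
  {g : Carrier Γ → ℕ} (g-poly : Poly Γ g)
  (acc≤g : ∀ γ us vs → us ++ vs ≡ xs γ →
           μ B (foldr (λ a b → f ((γ , a) , b)) (z γ) vs) ≤ g γ)
  where

  folded : Carrier Γ → List (Carrier A) → Carrier B
  folded γ = foldr (λ a b → f ((γ , a) , b)) (z γ)

  initR : Real Γ (listᴰ A ×ᴰ B) (λ γ → xs γ , z γ)
  initR = pairR xsR zR

  -- Variable 0 holds the remaining list with the start value of the fold, and the top of the stack
  -- the part reversed so far.
  reversing : Cmd 2
  reversing = while hd val run
    (suc zero := cons (cons (hd (hd val)) (hd stk)) (tl stk) ⨟ zero := cons (tl (hd val)) (tl val))

  -- The rest of the list is saved on the stack above `γ`, while variable 0 holds the argument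
  -- `((γ , a) , b)` on which `fR` runs.
  folding : Cmd 2
  folding = while hd val run
    (suc zero := cons (tl (hd val)) stk
    ⨟ zero := cons (cons (hd (tl stk)) (hd (hd val))) (tl val) ⨟ cmd fR
    ⨟ zero := cons (hd stk) val ⨟ suc zero := tl stk)

  reversing-run : ∀ us vs b s → Within reversing
    ((enc (listᴰ A) us ∙ b) ∷ (enc (listᴰ A) vs ∙ s) ∷ [])
    ((nil ∙ b) ∷ (enc (listᴰ A) (us ʳ++ vs) ∙ s) ∷ [])
    (suc (List.length us * 3))
  reversing-run []       vs b s = _ , exit refl , ≤-refl
  reversing-run (u ∷ us) vs b s with reversing-run us (u ∷ vs) b s
  ... | _ , e , t≤ = _ , loop (λ ()) (seq assign assign) e , s≤s (s≤s (s≤s t≤))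

  -- In the measure of an argument `((γ , a) , b)` the element `a` is bounded by the whole list and
  -- `b` by `g γ`, which makes the bound uniform over all steps.
  stepBound : Carrier Γ → ℕ
  stepBound γ = suc (suc (suc (μ Γ γ + μ (listᴰ A) (xs γ)) + g γ)) ^ degree (cost-poly fR)

  step≤ : ∀ γ us x vs → us ++ x ∷ vs ≡ xs γ →
          cost fR ((γ , x) , folded γ vs) ≤ stepBound γ
  step≤ γ us x vs eq = ≤-trans (bound (cost-poly fR) _)
    (^-monoˡ-≤ (degree (cost-poly fR)) (s≤s (s≤s (+-mono-≤
      (s≤s (+-monoʳ-≤ (μ Γ γ) (subst (λ ys → μ A x ≤ μ (listᴰ A) ys) eq (μ-member us x vs))))
      (acc≤g γ (us ++ x ∷ []) vs (trans (++-assoc us (x ∷ []) vs) eq))))))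

  -- The loop invariant: `us`, read backwards, is the part still to be consumed, and the accumulator
  -- is the fold over the remaining suffix `vs`.
  folding-run : ∀ γ us vs s → us ʳ++ vs ≡ xs γ → Within folding
    ((enc (listᴰ A) us ∙ enc B (folded γ vs)) ∷ (enc Γ γ ∙ s) ∷ [])
    ((nil ∙ enc B (folded γ (xs γ))) ∷ (enc Γ γ ∙ s) ∷ [])
    (suc (List.length us * (5 + stepBound γ)))
  folding-run γ []       vs s refl = _ , exit refl , ≤-refl
  folding-run γ (u ∷ us) vs s eq
    with run fR ((γ , u) , folded γ vs) (enc (listᴰ A) us ∙ enc Γ γ ∙ s)
       | folding-run γ us (u ∷ vs) s eq
  ... | t , e , t≤ | t′ , e′ , t′≤ =
    _ , loop (λ ()) (seq assign (seq assign (seq e (seq assign assign)))) e′ , time≤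
    where
    open ≤-Reasoning
    time≤ : suc (1 + (1 + (t + 2)) + t′) ≤ suc ((5 + stepBound γ) + List.length us * (5 + stepBound γ))
    time≤ = s≤s (begin
      2 + (t + 2) + t′ ≡⟨ cong (λ m → 2 + m + t′) (+-comm t 2) ⟩
      4 + t + t′       ≤⟨ +-mono-≤ (+-monoʳ-≤ 4 (≤-trans t≤
                            (step≤ γ _ u vs (trans (sym (ʳ++-defn us)) eq)))) t′≤ ⟩
      4 + stepBound γ + suc (List.length us * (5 + stepBound γ))
                       ≡⟨ +-suc (4 + stepBound γ) _ ⟩
      5 + stepBound γ + List.length us * (5 + stepBound γ) ∎)

  foldR : Real Γ B (λ γ → folded γ (xs γ))
  foldR = record
    { cmd = suc zero := cons val stk ⨟ cmd initR ⨟ suc zero := cons nil stk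
          ⨟ reversing ⨟ zero := cons (hd stk) (tl val) ⨟ suc zero := tl stk
          ⨟ folding ⨟ zero := tl val ⨟ suc zero := tl stk
    ; cost = λ γ → 1 + (cost initR γ + (1 + (suc (μ (listᴰ A) (xs γ) * 3)
        + (2 + (suc (μ (listᴰ A) (xs γ) * (5 + stepBound γ)) + 2)))))
    ; run = λ γ s → assigned ⨾ run initR γ _ ⨾ assigned
        ⨾ weaken (reversing-len γ) (reversing-run (xs γ) [] _ _)
        ⨾ assigned ⨾ assigned ⨾ weaken (folding-len γ)
           (folding-run γ (xs γ ʳ++ []) [] s (trans (ʳ++-ʳ++ (xs γ)) (++-identityʳ (xs γ))))
        ⨾ assigned ⨾ assigned
    ; cost-poly = poly-suc (poly-+ (cost-poly initR) (poly-suc (poly-+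
        (poly-suc (poly-* (growth xsR) (poly-const 3)))
        (poly-+ (poly-const 2) (poly-+ (poly-suc (poly-* (growth xsR)
          (poly-+ (poly-const 5) stepBound-poly))) (poly-const 2))))))
    ; growth = poly-≤ (λ γ → acc≤g γ [] (xs γ) refl) g-poly
    }
    where
    weaken : ∀ {c σ τ a b} → a ≤ b → Within c σ τ a → Within c σ τ b
    weaken a≤b (t , e , t≤a) = t , e , ≤-trans t≤a a≤b
    reversing-len : ∀ γ → suc (List.length (xs γ) * 3) ≤ suc (μ (listᴰ A) (xs γ) * 3)
    reversing-len γ = s≤s (*-monoˡ-≤ 3 (length≤μ {A} (xs γ)))
    folding-len : ∀ γ → suc (List.length (xs γ ʳ++ []) * (5 + stepBound γ))
                      ≤ suc (μ (listᴰ A) (xs γ) * (5 + stepBound γ))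
    folding-len γ = s≤s (*-monoˡ-≤ (5 + stepBound γ)
      (≤-trans (≤-reflexive (length-reverse (xs γ))) (length≤μ {A} (xs γ))))
    stepBound-poly : Poly Γ stepBound
    stepBound-poly = poly-^ (degree (cost-poly fR))
      (poly-suc (poly-suc (poly-+ (poly-suc (poly-+ poly-μ (growth xsR))) g-poly)))

open Fold public using (foldR)

-- Values of different types may share a tree. The program and its cost then carry over, and only
-- the growth has to be bounded anew.
recodeR : ∀ {Γ A B} {f : Carrier Γ → Carrier A} {g : Carrier Γ → Carrier B} →
          (∀ γ → enc A (f γ) ≡ enc B (g γ)) → Poly Γ (μ B ∘ g) →
          Real Γ A f → Real Γ B g
recodeR eq p r = record
  { cmd       = cmd r
  ; cost      = cost r
  ; run       = λ γ s → subst (λ y → Within _ _ (y ∷ _) _) (eq γ) (run r γ s)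
  ; cost-poly = cost-poly r
  ; growth    = p
  }

-- Arithmetic in unary

n≤μ : ∀ n → n ≤ μ unᴰ n
n≤μ n = m≤n⇒m≤1+n (m≤m+n n _)

module _ {Γ : Data} where

  constR : ∀ {A} (a : Carrier A) (e : Expr 2) → (∀ σ → eval σ e ≡ enc A a) →
           Real Γ A (λ _ → a)
  constR {A} a e eq = exprR e (λ _ _ → eq _) (poly-const (μ A a))

  zeroR : Real Γ unᴰ (λ _ → 0)
  zeroR = constR 0 nil (λ _ → refl)

  trueR : Real Γ boolᴰ (λ _ → true)
  trueR = constR true (cons nil nil) (λ _ → refl)

  falseR : Real Γ boolᴰ (λ _ → false)
  falseR = constR false nil (λ _ → refl)

  nilR : ∀ {A} → Real Γ (listᴰ A) (λ _ → [])
  nilR = constR [] nil (λ _ → refl)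

  un-poly : ∀ {f : Carrier Γ → ℕ} → Poly Γ f → Poly Γ (μ unᴰ ∘ f)
  un-poly p = poly-suc (poly-* (poly-const 2) p)

  value-poly : ∀ {f : Carrier Γ → ℕ} → Real Γ unᴰ f → Poly Γ f
  value-poly r = poly-≤ (λ γ → n≤μ _) (growth r)

sucR : Real unᴰ unᴰ suc
sucR = exprR (cons nil val) (λ _ _ → refl) (un-poly (poly-suc (poly-≤ n≤μ poly-μ)))

predR : Real unᴰ unᴰ pred
predR = exprR (tl val) (λ { zero _ → refl ; (suc _) _ → refl })
  (un-poly (poly-≤ (λ n → ≤-trans pred[n]≤n (n≤μ n)) poly-μ))

consR : ∀ {A} → Real (A ×ᴰ listᴰ A) (listᴰ A) (λ (x , xs) → x ∷ xs)
consR = exprR val (λ _ _ → refl) poly-μ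

suffix-length : ∀ {X : Set} (us : List X) {vs xs} → us ++ vs ≡ xs → List.length vs ≤ List.length xs
suffix-length us {vs} refl = ≤-trans (m≤n+m _ _) (≤-reflexive (sym (length-++ us)))

module _ {Γ B : Data} {n : Carrier Γ → ℕ} {z : Carrier Γ → Carrier B}
         {f : Carrier Γ × Carrier B → Carrier B} where

  -- A unary number has the same tree as a list of that many units, so iteration is a fold over a
  -- list.
  foldℕR : Real Γ unᴰ n → Real Γ B z → Real (Γ ×ᴰ B) B f →
           ∀ {g} → Poly Γ g →
           (∀ γ m → m ≤ n γ → μ B (fold (z γ) (λ b → f (γ , b)) m) ≤ g γ) →
           Real Γ B (λ γ → fold (z γ) (λ b → f (γ , b)) (n γ))
  foldℕR nR zR fR {g} g-poly acc≤g =
    castR (λ γ → trans (foldr-fold γ (List.replicate (n γ) tt))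
                       (cong (fold (z γ) (λ b → f (γ , b))) (length-replicate (n γ))))
      (foldR ticks zR (fR ∘R pairR (fstR ∘R fstR) sndR) g-poly
        (λ γ us vs eq → subst (λ b → μ B b ≤ g γ) (sym (foldr-fold γ vs))
          (acc≤g γ _ (≤-trans (suffix-length us eq) (≤-reflexive (length-replicate (n γ)))))))
    where
    foldr-fold : ∀ γ (ts : List ⊤) →
                 foldr (λ _ b → f (γ , b)) (z γ) ts ≡ fold (z γ) (λ b → f (γ , b)) (List.length ts)
    foldr-fold γ []       = refl
    foldr-fold γ (t ∷ ts) = cong (λ b → f (γ , b)) (foldr-fold γ ts)

    unary-list : ∀ m → unary m ≡ enc (listᴰ unitᴰ) (List.replicate m tt)
    unary-list zero    = refl
    unary-list (suc m) = cong (nil ∙_) (unary-list m)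

    μ-ticks : ∀ m → μ (listᴰ unitᴰ) (List.replicate m tt) ≡ μ unᴰ m
    μ-ticks zero    = refl
    μ-ticks (suc m) = cong (λ k → suc (suc k)) (trans (μ-ticks m) (sym (+-suc m (m + 0))))

    ticks : Real Γ (listᴰ unitᴰ) (λ γ → List.replicate (n γ) tt)
    ticks = recodeR (λ γ → unary-list (n γ))
      (poly-≤ (λ γ → ≤-reflexive (μ-ticks (n γ))) (growth nR)) nR

μ-mono : ∀ {m n} → m ≤ n → μ unᴰ m ≤ μ unᴰ n
μ-mono m≤n = s≤s (*-monoʳ-≤ 2 m≤n)

addR : Real (unᴰ ×ᴰ unᴰ) unᴰ (λ (m , n) → m + n)
addR = castR (λ (m , n) → fold-suc m n)
  (foldℕR fstR sndR (sucR ∘R sndR)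
    (un-poly (poly-+ (value-poly fstR) (value-poly sndR)))
    (λ (m , n) j j≤m → μ-mono (≤-trans (≤-reflexive (fold-suc j n)) (+-monoˡ-≤ n j≤m))))
  where
  fold-suc : ∀ m n → fold n suc m ≡ m + n
  fold-suc zero    n = refl
  fold-suc (suc m) n = cong suc (fold-suc m n)

monusR : Real (unᴰ ×ᴰ unᴰ) unᴰ (λ (m , n) → m ∸ n)
monusR = castR (λ (m , n) → fold-pred m n)
  (foldℕR sndR fstR (predR ∘R sndR) (un-poly (value-poly fstR))
    (λ (m , n) j _ → μ-mono (≤-trans (≤-reflexive (fold-pred m j)) (m∸n≤m m j))))
  where
  fold-pred : ∀ m n → fold m pred n ≡ m ∸ n
  fold-pred m zero    = refl
  fold-pred m (suc n) = trans (cong pred (fold-pred m n)) (pred[m∸n]≡m∸[1+n] m n)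

mulR : Real (unᴰ ×ᴰ unᴰ) unᴰ (λ (m , n) → m * n)
mulR = castR (λ (m , n) → fold-+ m n)
  (foldℕR fstR zeroR (ap₂ addR (sndR ∘R fstR) sndR)
    (un-poly (poly-* (value-poly fstR) (value-poly sndR)))
    (λ (m , n) j j≤m → μ-mono (≤-trans (≤-reflexive (fold-+ j n)) (*-monoˡ-≤ n j≤m))))
  where
  fold-+ : ∀ m n → fold 0 (n +_) m ≡ m * n
  fold-+ zero    n = refl
  fold-+ (suc m) n = cong (n +_) (fold-+ m n)

encodeBool≤3 : ∀ b → μ boolᴰ b ≤ 3
encodeBool≤3 false = s≤s z≤n
encodeBool≤3 true  = ≤-refl

equalR : Real (unᴰ ×ᴰ unᴰ) boolᴰ (λ (m , n) → m ≡ᵇ n)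
equalR = castR (λ (m , n) → distance m n)
  -- The two truncated differences add up to zero exactly when the numbers are equal, and iterating
  -- the constant function `false` from `true` tests for zero.
  (foldℕR (ap₂ addR monusR (ap₂ monusR sndR fstR)) trueR falseR
    (poly-const 3) (λ _ _ _ → encodeBool≤3 _))
  where
  distance : ∀ m n → fold true (λ _ → false) ((m ∸ n) + (n ∸ m)) ≡ (m ≡ᵇ n)
  distance zero    zero    = refl
  distance zero    (suc n) = refl
  distance (suc m) zero    = refl
  distance (suc m) (suc n) = distance m n

minR : Real (unᴰ ×ᴰ unᴰ) unᴰ (λ (m , n) → m ⊓ n)
minR = castR (λ (m , n) → m∸[m∸n] m n) (ap₂ monusR fstR monusR)
  where
  m∸[m∸n] : ∀ m n → m ∸ (m ∸ n) ≡ m ⊓ n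
  m∸[m∸n] m n with ≤-total m n
  ... | inj₁ m≤n = trans (cong (m ∸_) (m≤n⇒m∸n≡0 m≤n)) (sym (m≤n⇒m⊓n≡m m≤n))
  ... | inj₂ n≤m = trans (m∸[m∸n]≡n n≤m) (sym (m≥n⇒m⊓n≡n n≤m))

maxR : Real (unᴰ ×ᴰ unᴰ) unᴰ (λ (m , n) → m ⊔ n)
maxR = castR (λ (m , n) → sym (m⊔n≡m+[n∸m] m n)) (ap₂ addR fstR (ap₂ monusR sndR fstR))
  where
  m⊔n≡m+[n∸m] : ∀ m n → m ⊔ n ≡ m + (n ∸ m)
  m⊔n≡m+[n∸m] zero    n       = refl
  m⊔n≡m+[n∸m] (suc m) zero    = cong suc (sym (+-identityʳ m))
  m⊔n≡m+[n∸m] (suc m) (suc n) = cong suc (m⊔n≡m+[n∸m] m n)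

module _ {A : Data} where

  -- Exactness passes from elements to lists. For Boolean matrices this later identifies the measure
  -- with the size of the encoded graph.
  μ≡size : (∀ x → μ A x ≡ size (enc A x)) → ∀ xs → μ (listᴰ A) xs ≡ size (enc (listᴰ A) xs)
  μ≡size h []       = refl
  μ≡size h (x ∷ xs) = cong suc (cong₂ _+_ (h x) (μ≡size h xs))

-- Binary numerals

digitsᴰ : Data
digitsᴰ = listᴰ boolᴰ

-- The digits 2 and 1 of bijective binary become `false` and `true`, as in `encodeℕᵇ`; so a number
-- and its list of digits are the same tree.
digits : ℕᵇ → List Bool
digits ℕᵇ.zero  = []
digits 2[1+ x ] = false ∷ digits x
digits 1+[2 x ] = true ∷ digits x

encode-digits : ∀ x → enc digitsᴰ (digits x) ≡ encodeℕᵇ x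
encode-digits ℕᵇ.zero  = refl
encode-digits 2[1+ x ] = cong (_ ∙_) (encode-digits x)
encode-digits 1+[2 x ] = cong (_ ∙_) (encode-digits x)

bin-poly : ∀ {Γ} {f : Carrier Γ → ℕ} → Poly Γ f → Poly Γ (μ binᴰ ∘ f)
bin-poly p = poly-suc (poly-* (poly-const 4) p)

digitsR : Real binᴰ digitsᴰ (digits ∘ ℕᵇ.fromℕ)
digitsR = exprR val (λ n _ → sym (encode-digits (ℕᵇ.fromℕ n)))
  (poly-≤ (λ n → ≤-trans (≤-reflexive (trans (μ≡size (λ _ → refl) (digits (ℕᵇ.fromℕ n)))
                             (cong size (encode-digits (ℕᵇ.fromℕ n)))))
                   (size≤μ binᴰ n)) poly-μ)

-- The digit 1 becomes 2 without a carry, and 2 becomes 1 with a carry into the rest.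
sucDigits : List Bool → List Bool
sucDigits []           = true ∷ []
sucDigits (false ∷ ds) = true ∷ sucDigits ds
sucDigits (true ∷ ds)  = false ∷ ds

digits-suc : ∀ x → sucDigits (digits x) ≡ digits (ℕᵇ.suc x)
digits-suc ℕᵇ.zero  = refl
digits-suc 2[1+ x ] = cong (true ∷_) (digits-suc x)
digits-suc 1+[2 x ] = refl

-- The fold carries along the digits already seen, because it is the old tail
-- that remains when there is no carry.
sucDigitsR : Real digitsᴰ digitsᴰ sucDigits
sucDigitsR = castR (λ ds → cong proj₂ (carry ds))
  (sndR ∘R foldR {A = boolᴰ} {B = digitsᴰ ×ᴰ digitsᴰ} idR (pairR nilR (ap₂ consR trueR nilR))
    (pairR (ap₂ consR digit rest)
       (ifR digit (ap₂ consR falseR rest) (ap₂ consR trueR (sndR ∘R sndR))))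
    (poly-suc (poly-+ poly-μ (poly-+ (poly-const 4) (poly-* (poly-const 2) poly-μ))))
    (λ ds us vs eq → ≤-trans (≤-reflexive (cong (μ (digitsᴰ ×ᴰ digitsᴰ)) (carry vs)))
      (s≤s (≤-trans (+-monoʳ-≤ _ (μ-suc vs))
        (subst (λ xs → μ digitsᴰ vs + (4 + 2 * μ digitsᴰ vs) ≤ μ digitsᴰ xs + (4 + 2 * μ digitsᴰ xs)) eq
          (+-mono-≤ (μ-suffix us vs) (+-monoʳ-≤ 4 (*-monoʳ-≤ 2 (μ-suffix us vs)))))))))
  where
  digit : Real ((digitsᴰ ×ᴰ boolᴰ) ×ᴰ (digitsᴰ ×ᴰ digitsᴰ)) boolᴰ (proj₂ ∘ proj₁)
  digit = sndR ∘R fstR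

  rest : Real ((digitsᴰ ×ᴰ boolᴰ) ×ᴰ (digitsᴰ ×ᴰ digitsᴰ)) digitsᴰ (proj₁ ∘ proj₂)
  rest = fstR ∘R sndR

  carry : ∀ ds → foldr (λ d (xs , ys) → d ∷ xs , (ifᵇ d then false ∷ xs else (true ∷ ys)))
                       ([] , true ∷ []) ds ≡ (ds , sucDigits ds)
  carry []           = refl
  carry (true ∷ ds)  rewrite carry ds = refl
  carry (false ∷ ds) rewrite carry ds = refl

  -- A digit that turns from `false` to `true` contributes 4 nodes instead of 2, hence the factor 2;
  -- the summand 4 covers a new last digit.
  μ-suc : ∀ ds → μ digitsᴰ (sucDigits ds) ≤ 4 + 2 * μ digitsᴰ ds
  μ-suc []           = s≤s (s≤s (s≤s (s≤s (s≤s z≤n))))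
  μ-suc (false ∷ ds) = ≤-trans (+-monoʳ-≤ 4 (μ-suc ds)) (≤-reflexive
    (flip-bit (μ digitsᴰ ds)))
    where
    flip-bit : ∀ m → 8 + 2 * m ≡ 4 + 2 * (2 + m)
    flip-bit = solve-∀
  μ-suc (true ∷ ds)  = s≤s (s≤s (≤-trans (m≤n+m (μ digitsᴰ ds) 2)
    (+-monoʳ-≤ 2 (≤-trans (m≤n+m _ 4) (m≤m+n _ _)))))

fromℕ-suc : ∀ n → ℕᵇ.fromℕ (suc n) ≡ ℕᵇ.suc (ℕᵇ.fromℕ n)
fromℕ-suc n = trans (fromℕ≡fromℕ' (suc n)) (cong ℕᵇ.suc (sym (fromℕ≡fromℕ' n)))

sucBinR : Real binᴰ binᴰ suc
sucBinR = recodeR {A = digitsᴰ}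
  (λ n → trans (cong (enc digitsᴰ) (trans (digits-suc _) (cong digits (sym (fromℕ-suc n)))))
               (encode-digits (ℕᵇ.fromℕ (suc n))))
  (bin-poly (poly-suc (poly-≤ (λ n → m≤n⇒m≤1+n (m≤m+n n _)) poly-μ)))
  (sucDigitsR ∘R digitsR)

fold-id : ∀ n → fold 0 suc n ≡ n
fold-id zero    = refl
fold-id (suc n) = cong suc (fold-id n)

toBinaryR : Real unᴰ binᴰ (λ n → n)
toBinaryR = castR fold-id
  (foldℕR idR (constR 0 nil (λ _ → refl)) (sucBinR ∘R sndR) (bin-poly (value-poly idR))
    (λ n j j≤n → s≤s (*-monoʳ-≤ 4 (≤-trans (≤-reflexive (fold-id j)) j≤n))))

addDigit : Bool → ℕ → ℕ
addDigit d m = ifᵇ d then suc (m + m) else suc (suc (m + m))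

value-digits : ∀ x → foldr addDigit 0 (digits x) ≡ ℕᵇ.toℕ x
value-digits ℕᵇ.zero  = refl
value-digits 2[1+ x ] rewrite value-digits x = cong suc
  (trans (sym (+-suc (ℕᵇ.toℕ x) _)) (cong (λ m → ℕᵇ.toℕ x + suc m) (sym (+-identityʳ _))))
value-digits 1+[2 x ] rewrite value-digits x = cong (λ m → suc (ℕᵇ.toℕ x + m)) (sym (+-identityʳ _))

-- Every further digit at least doubles the value. So although the accumulator of the decoding
-- doubles repeatedly, it never exceeds the number decoded.
value-suffix : ∀ us vs → foldr addDigit 0 vs ≤ foldr addDigit 0 (us ++ vs)
value-suffix []           vs = ≤-refl
value-suffix (true ∷ us)  vs = m≤n⇒m≤1+n (≤-trans (value-suffix us vs) (m≤m+n _ _))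
value-suffix (false ∷ us) vs = m≤n⇒m≤1+n (m≤n⇒m≤1+n (≤-trans (value-suffix us vs) (m≤m+n _ _)))

toUnaryR : Real binᴰ unᴰ (λ n → n)
toUnaryR = castR value
  (foldR {xs = digits ∘ ℕᵇ.fromℕ} {z = λ _ → 0} {f = λ ((_ , d) , m) → addDigit d m}
    digitsR zeroR
    (ifR (sndR ∘R fstR) (sucR ∘R ap₂ addR sndR sndR) (sucR ∘R sucR ∘R ap₂ addR sndR sndR))
    (un-poly (poly-≤ (λ n → m≤n⇒m≤1+n (m≤m+n n _)) poly-μ))
    (λ n us vs eq → μ-mono (≤-trans (value-suffix us vs)
      (≤-reflexive (trans (cong (foldr addDigit 0) eq) (value n))))))
  where
  value : ∀ n → foldr addDigit 0 (digits (ℕᵇ.fromℕ n)) ≡ n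
  value n = trans (value-digits (ℕᵇ.fromℕ n)) (toℕ-fromℕ n)

-- Operations on lists

module _ {Γ A B : Data} {xs : Carrier Γ → List (Carrier A)} {f : Carrier Γ × Carrier A → Carrier B} where

  mapR : Real (Γ ×ᴰ A) B f → Real Γ (listᴰ A) xs →
         Real Γ (listᴰ B) (λ γ → List.map (λ x → f (γ , x)) (xs γ))
  mapR fR xsR = castR (λ γ → map-foldr γ (xs γ))
    (foldR xsR nilR (ap₂ consR (fR ∘R fstR) sndR)
      {g = λ γ → suc (μ (listᴰ A) (xs γ) * suc (imageBound γ))}
      (poly-suc (poly-* (growth xsR) (poly-suc (poly-^ (degree (growth fR))
        (poly-suc (poly-suc (poly-+ poly-μ (growth xsR))))))))
      acc≤)
    where
    map-foldr : ∀ γ ys → foldr (λ y zs → f (γ , y) ∷ zs) [] ys ≡ List.map (λ x → f (γ , x)) ys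
    map-foldr γ []       = refl
    map-foldr γ (y ∷ ys) = cong (_ ∷_) (map-foldr γ ys)

    imageBound : Carrier Γ → ℕ
    imageBound γ = suc (suc (μ Γ γ + μ (listᴰ A) (xs γ))) ^ degree (growth fR)

    member : ∀ γ us vs → us ++ vs ≡ xs γ →
             μ (listᴰ B) (List.map (λ x → f (γ , x)) vs) ≤ suc (List.length vs * suc (imageBound γ))
    member γ us []       eq = ≤-refl
    member γ us (v ∷ vs) eq = s≤s (≤-trans
      (+-mono-≤ (≤-trans (bound (growth fR) (γ , v)) (^-monoˡ-≤ (degree (growth fR))
                  (s≤s (s≤s (+-monoʳ-≤ (μ Γ γ)
                    (subst (λ ys → μ A v ≤ μ (listᴰ A) ys) eq (μ-member us v vs)))))))
                (member γ (us ++ v ∷ []) vs (trans (++-assoc us (v ∷ []) vs) eq)))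
      (≤-reflexive (+-suc (imageBound γ) _)))

    acc≤ : ∀ γ us vs → us ++ vs ≡ xs γ →
           μ (listᴰ B) (foldr (λ y zs → f (γ , y) ∷ zs) [] vs) ≤ suc (μ (listᴰ A) (xs γ) * suc (imageBound γ))
    acc≤ γ us vs eq rewrite map-foldr γ vs = ≤-trans (member γ us vs eq)
      (s≤s (*-monoˡ-≤ (suc (imageBound γ)) (≤-trans (suffix-length us eq) (length≤μ {A} (xs γ)))))

module _ {A : Data} where

  μ-++ : ∀ xs ys → μ (listᴰ A) (xs ++ ys) ≤ μ (listᴰ A) xs + μ (listᴰ A) ys
  μ-++ []       ys = n≤1+n _
  μ-++ (x ∷ xs) ys = s≤s (≤-trans (+-monoʳ-≤ (μ A x) (μ-++ xs ys))
                           (≤-reflexive (sym (+-assoc (μ A x) _ _))))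

  appendR : Real (listᴰ A ×ᴰ listᴰ A) (listᴰ A) (λ (xs , ys) → xs ++ ys)
  appendR = castR (λ (xs , ys) → append xs ys)
    (foldR fstR sndR (ap₂ consR (sndR ∘R fstR) sndR)
      (poly-+ (growth (fstR {listᴰ A} {listᴰ A})) (growth (sndR {listᴰ A} {listᴰ A})))
      (λ (xs , ys) us vs eq → ≤-trans (≤-reflexive (cong (μ (listᴰ A)) (append vs ys)))
        (≤-trans (μ-++ vs ys) (+-monoˡ-≤ (μ (listᴰ A) ys)
          (subst (λ ws → μ (listᴰ A) vs ≤ μ (listᴰ A) ws) eq (μ-suffix us vs))))))
    where
    append : ∀ xs ys → foldr _∷_ ys xs ≡ xs ++ ys
    append []       ys = refl
    append (x ∷ xs) ys = cong (x ∷_) (append xs ys)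

  lengthR : Real (listᴰ A) unᴰ List.length
  lengthR = castR count
    (foldR idR zeroR (sucR ∘R sndR) (un-poly (poly-≤ (length≤μ {A}) poly-μ))
      (λ xs us vs eq → μ-mono (≤-trans (≤-reflexive (count vs)) (suffix-length us eq))))
    where
    count : ∀ xs → foldr (λ _ m → suc m) 0 xs ≡ List.length xs
    count []       = refl
    count (x ∷ xs) = cong suc (count xs)

  replicateR : Real (unᴰ ×ᴰ A) (listᴰ A) (λ (n , x) → List.replicate n x)
  replicateR = castR (λ (n , x) → repeat x n)
    (foldℕR fstR nilR (ap₂ consR (sndR ∘R fstR) sndR)
      {g = λ (n , x) → suc (n * suc (μ A x))}
      (poly-suc (poly-* (value-poly fstR) (poly-suc (growth (sndR {unᴰ} {A})))))
      (λ (n , x) j j≤n → ≤-trans (≤-reflexive (trans (cong (μ (listᴰ A)) (repeat x j)) (μ-repeat x j)))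
        (s≤s (*-monoˡ-≤ (suc (μ A x)) j≤n))))
    where
    repeat : ∀ x n → fold [] (x ∷_) n ≡ List.replicate n x
    repeat x zero    = refl
    repeat x (suc n) = cong (x ∷_) (repeat x n)

    μ-repeat : ∀ x n → μ (listᴰ A) (List.replicate n x) ≡ suc (n * suc (μ A x))
    μ-repeat x zero    = refl
    μ-repeat x (suc n) = cong suc (trans (cong (μ A x +_) (μ-repeat x n)) (+-suc (μ A x) _))

module _ {A : Data} where

  concatR : Real (listᴰ (listᴰ A)) (listᴰ A) List.concat
  concatR = castR flatten
    (foldR idR nilR (ap₂ appendR (sndR ∘R fstR) sndR) (poly-μ {listᴰ (listᴰ A)})
      (λ xss us vs eq → ≤-trans (≤-reflexive (cong (μ (listᴰ A)) (flatten vs)))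
        (≤-trans (μ-concat vs) (subst (λ ws → μ (listᴰ (listᴰ A)) vs ≤ μ (listᴰ (listᴰ A)) ws) eq
          (μ-suffix us vs)))))
    where
    flatten : ∀ xss → foldr _++_ [] xss ≡ List.concat xss
    flatten []         = refl
    flatten (xs ∷ xss) = cong (xs ++_) (flatten xss)

    μ-concat : ∀ xss → μ (listᴰ A) (List.concat xss) ≤ μ (listᴰ (listᴰ A)) xss
    μ-concat []         = ≤-refl
    μ-concat (xs ∷ xss) = ≤-trans (μ-++ xs _)
      (m≤n⇒m≤1+n (+-monoʳ-≤ (μ (listᴰ A) xs) (μ-concat xss)))

index : ∀ {X : Set} → ℕ → List X → List (ℕ × X)
index m []       = []
index m (x ∷ xs) = (m , x) ∷ index (suc m) xs

module _ {A : Data} where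

  indexR : Real (listᴰ A) (listᴰ (unᴰ ×ᴰ A)) (index 0)
  indexR = castR (λ xs → number (List.length xs) 0 xs refl)
    (foldR idR nilR (ap₂ consR (pairR position (sndR ∘R fstR)) sndR)
      {g = λ xs → μ (listᴰ A) xs + List.length xs * (2 + 2 * List.length xs)}
      (poly-+ poly-μ (poly-* len (poly-+ (poly-const 2) (poly-* (poly-const 2) len))))
      (λ xs us vs eq → ≤-trans (acc≤ (List.length xs) vs) (+-mono-≤
        (subst (λ ws → μ (listᴰ A) vs ≤ μ (listᴰ A) ws) eq (μ-suffix us vs))
        (*-monoˡ-≤ (2 + 2 * List.length xs) (suffix-length us eq)))))
    where
    -- The fold meets the elements from last to first. A position is therefore the total length less
    -- the number of elements already numbered, less one.
    acc : ℕ → List (Carrier A) → List (ℕ × Carrier A)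
    acc N = foldr (λ x ys → (N ∸ suc (List.length ys) , x) ∷ ys) []

    position : Real ((listᴰ A ×ᴰ A) ×ᴰ listᴰ (unᴰ ×ᴰ A)) unᴰ
                    (λ ((xs , _) , ys) → List.length xs ∸ suc (List.length ys))
    position = ap₂ monusR (lengthR ∘R fstR ∘R fstR) (sucR ∘R lengthR ∘R sndR)

    len : Poly (listᴰ A) List.length
    len = poly-≤ (length≤μ {A}) poly-μ

    length-acc : ∀ N xs → List.length (acc N xs) ≡ List.length xs
    length-acc N []       = refl
    length-acc N (x ∷ xs) = cong suc (length-acc N xs)

    number : ∀ N m xs → m + List.length xs ≡ N → acc N xs ≡ index m xs
    number N m []       eq = refl
    number N m (x ∷ xs) eq = cong₂ (λ i ys → (i , x) ∷ ys)
      (trans (cong₂ (λ N j → N ∸ suc j) (sym eq) (length-acc N xs)) (m+n∸n≡m m (suc (List.length xs))))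
      (number N (suc m) xs (trans (sym (+-suc m _)) eq))

    acc≤ : ∀ N vs → μ (listᴰ (unᴰ ×ᴰ A)) (acc N vs)
                  ≤ μ (listᴰ A) vs + List.length vs * (2 + 2 * N)
    acc≤ N []       = ≤-refl
    acc≤ N (v ∷ vs) = ≤-trans
      (s≤s (s≤s (s≤s (+-mono-≤
        (+-monoˡ-≤ (μ A v) (*-monoʳ-≤ 2 (m∸n≤m N (suc (List.length (acc N vs)))))) (acc≤ N vs)))))
      (≤-reflexive (rearrange (2 * N) (μ A v) (μ (listᴰ A) vs) (List.length vs * (2 + 2 * N))))
      where
      rearrange : ∀ p q r s → 3 + (p + q + (r + s)) ≡ suc (q + r) + (2 + p + s)
      rearrange = solve-∀

-- The program of the reduction

orR : Real (boolᴰ ×ᴰ boolᴰ) boolᴰ (λ (a , b) → a ∨ b)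
orR = castR (λ { (true , _) → refl ; (false , _) → refl }) (ifR fstR trueR sndR)

notR : Real boolᴰ boolᴰ not
notR = castR (λ { true → refl ; false → refl }) (ifR idR falseR trueR)

-- A kind (true , i , j) is a pair joined to the points i and j; for a point the
-- numbers are junk. An item is the index of a vertex of H with its kind.
kindᴰ itemᴰ : Data
kindᴰ = boolᴰ ×ᴰ unᴰ ×ᴰ unᴰ
itemᴰ = unᴰ ×ᴰ kindᴰ

Kind Item : Set
Kind = Carrier kindᴰ
Item = Carrier itemᴰ

pattern point = false , 0 , 0

pairs : List (List Bool) → List Kind
pairs M = List.concat (List.map (λ (i , row) →
  List.map (λ (j , b) → (b ∨ (i ≡ᵇ j)) , i , j) (index 0 row)) (index 0 M))

-- The vertices of the given graph come first, so that vertex `i` has index `i`, with which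
-- `adjacent` compares the numbers stored in a pair.
kinds : List (List Bool) → ℕ → List Kind
kinds M k = List.replicate (List.length M) point ++ (pairs M ++ List.replicate (suc k * suc k) point)

adjacent : Item → Item → Bool
adjacent (s , a , i , j) (t , b , i′ , j′) =
  ifᵇ a then (ifᵇ b then false else ((t ≡ᵇ i) ∨ (t ≡ᵇ j)))
        else (ifᵇ b then (s ≡ᵇ i′) ∨ (s ≡ᵇ j′) else not (s ≡ᵇ t))

-- N is the number of vertices of H. The first track is reversed, so that the
-- points to cover lie to the right of the left end on all three tracks. For
-- i ≡ j the subtraction gives 0, and the interval on the second track lies
-- between two consecutive points.
span : ℕ → Item → ℕ
span N (t , a , i , j) = ifᵇ a then (2 + N) * ((i ⊔ j) ∸ suc (i ⊓ j)) + N else 0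

-- A pair starts one unit after a point that it must avoid: the minimum of `i` and `j` on the first
-- two tracks, their maximum on the third.
left₀ left₁ left₂ : ℕ → Item → ℕ
left₀ N (t , a , i , j) = ifᵇ a then suc (N ∸ (i ⊓ j)) else (N ∸ t)
left₁ N (t , a , i , j) = ifᵇ a then suc ((2 + N) * (i ⊓ j)) else ((2 + N) * t)
left₂ N (t , a , i , j) = ifᵇ a then suc (i ⊔ j) else t

tracks : ℕ → Item → List (ℕ × ℕ)
tracks N u = track left₀ ∷ track left₁ ∷ track left₂ ∷ []
  where
  track : (ℕ → Item → ℕ) → ℕ × ℕ
  track left = left N u , left N u + span N u

inputᴰ outputᴰ : Data
inputᴰ  = listᴰ (listᴰ boolᴰ) ×ᴰ binᴰ
outputᴰ = listᴰ (listᴰ boolᴰ) ×ᴰ listᴰ (listᴰ (ratᴰ ×ᴰ ratᴰ)) ×ᴰ binᴰ ×ᴰ binᴰ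

describe : List Item → List (List Bool) × List (List (ℕ × ℕ))
describe is = List.map (λ u → List.map (λ v → adjacent u v) is) is
            , List.map (λ u → tracks (List.length is) u) is

reduce : Carrier inputᴰ → Carrier outputᴰ
reduce (M , k) = proj₁ d , proj₂ d , k , k * k
  where d = describe (index 0 (kinds M k))

pairsR : Real (listᴰ (listᴰ boolᴰ)) (listᴰ kindᴰ) pairs
pairsR = concatR ∘R mapR
  (mapR (pairR (ap₂ orR (sndR ∘R sndR) (ap₂ equalR row column)) (pairR row column))
        (indexR ∘R sndR ∘R sndR)) indexR
  where
  Γ : Data
  Γ = (listᴰ (listᴰ boolᴰ) ×ᴰ (unᴰ ×ᴰ listᴰ boolᴰ)) ×ᴰ (unᴰ ×ᴰ boolᴰ)
  row : Real Γ unᴰ (λ ((_ , (i , _)) , _) → i)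
  row = fstR ∘R sndR ∘R fstR
  column : Real Γ unᴰ (λ (_ , (j , _)) → j)
  column = fstR ∘R sndR

pointR : ∀ {Γ} → Real Γ kindᴰ (λ _ → point)
pointR = constR point (cons nil (cons nil nil)) (λ _ → refl)

kindsR : Real (listᴰ (listᴰ boolᴰ) ×ᴰ unᴰ) (listᴰ kindᴰ) (λ (M , k) → kinds M k)
kindsR = ap₂ appendR (ap₂ replicateR (lengthR ∘R fstR) pointR)
  (ap₂ appendR (pairsR ∘R fstR) (ap₂ replicateR (ap₂ mulR (sucR ∘R sndR) (sucR ∘R sndR)) pointR))

isPairR : Real itemᴰ boolᴰ (λ (_ , a , _) → a)
isPairR = fstR ∘R sndR

firstR : Real itemᴰ unᴰ (λ (_ , _ , i , _) → i)
firstR = fstR ∘R sndR ∘R sndR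

secondR : Real itemᴰ unᴰ (λ (_ , _ , _ , j) → j)
secondR = sndR ∘R sndR ∘R sndR

adjacentR : Real (itemᴰ ×ᴰ itemᴰ) boolᴰ (λ (u , v) → adjacent u v)
adjacentR = ifR (isPairR ∘R fstR)
  (ifR (isPairR ∘R sndR) falseR
    (ap₂ orR (ap₂ equalR (fstR ∘R sndR) (firstR ∘R fstR))
             (ap₂ equalR (fstR ∘R sndR) (secondR ∘R fstR))))
  (ifR (isPairR ∘R sndR)
    (ap₂ orR (ap₂ equalR (fstR ∘R fstR) (firstR ∘R sndR))
             (ap₂ equalR (fstR ∘R fstR) (secondR ∘R sndR)))
    (notR ∘R ap₂ equalR (fstR ∘R fstR) (fstR ∘R sndR)))

toRatR : Real unᴰ ratᴰ (λ n → n)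
toRatR = exprR {binᴰ} {ratᴰ} (cons (cons nil val) (cons (cons nil nil) nil)) (λ _ _ → refl)
  (poly-≤ (λ n → ≤-refl) (poly-+ (poly-const 8) poly-μ)) ∘R toBinaryR

module _ where
  private
    Γ : Data
    Γ = unᴰ ×ᴰ itemᴰ

    positionR : Real Γ unᴰ (λ (_ , t , _) → t)
    positionR = fstR ∘R sndR

    scaleR : Real Γ unᴰ (λ (N , _) → 2 + N)
    scaleR = sucR ∘R sucR ∘R fstR

    lowR : Real Γ unᴰ (λ (_ , _ , _ , i , j) → i ⊓ j)
    lowR = ap₂ minR (firstR ∘R sndR) (secondR ∘R sndR)

    highR : Real Γ unᴰ (λ (_ , _ , _ , i , j) → i ⊔ j)
    highR = ap₂ maxR (firstR ∘R sndR) (secondR ∘R sndR)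

    ifPairR : ∀ {f g} → Real Γ unᴰ f → Real Γ unᴰ g →
              Real Γ unᴰ (λ γ → ifᵇ proj₁ (proj₂ (proj₂ γ)) then f γ else g γ)
    ifPairR = ifR (isPairR ∘R sndR)

    spanR : Real Γ unᴰ (λ (N , u) → span N u)
    spanR = ifPairR
      (ap₂ addR (ap₂ mulR scaleR (ap₂ monusR highR (sucR ∘R lowR))) fstR) zeroR

    trackR : ∀ {left} → Real Γ unᴰ left →
             Real Γ (ratᴰ ×ᴰ ratᴰ) (λ γ → left γ , left γ + span (proj₁ γ) (proj₂ γ))
    trackR leftR = pairR (toRatR ∘R leftR) (toRatR ∘R ap₂ addR leftR spanR)

  tracksR : Real (unᴰ ×ᴰ itemᴰ) (listᴰ (ratᴰ ×ᴰ ratᴰ)) (λ (N , u) → tracks N u)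
  tracksR =
    ap₂ consR (trackR (ifPairR (sucR ∘R ap₂ monusR fstR lowR) (ap₂ monusR fstR positionR)))
    (ap₂ consR (trackR (ifPairR (sucR ∘R ap₂ mulR scaleR lowR) (ap₂ mulR scaleR positionR)))
    (ap₂ consR (trackR (ifPairR (sucR ∘R highR) positionR)) nilR))

describeR : Real (listᴰ itemᴰ) (listᴰ (listᴰ boolᴰ) ×ᴰ listᴰ (listᴰ (ratᴰ ×ᴰ ratᴰ))) describe
describeR = pairR (mapR (mapR (ap₂ adjacentR (sndR ∘R fstR) sndR) fstR) idR)
                  (mapR (ap₂ tracksR (lengthR ∘R fstR) sndR) idR)

abstract
  reduceR : Real inputᴰ outputᴰ reduce
  reduceR = letR (describeR ∘R indexR ∘R kindsR ∘R pairR fstR (toUnaryR ∘R sndR))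
    (pairR (fstR ∘R sndR) (pairR (sndR ∘R sndR)
      (pairR (sndR ∘R fstR) (toBinaryR ∘R ap₂ mulR parameter parameter))))
    where
    parameter : Real (inputᴰ ×ᴰ (listᴰ (listᴰ boolᴰ) ×ᴰ listᴰ (listᴰ (ratᴰ ×ᴰ ratᴰ)))) unᴰ
                     (λ ((_ , k) , _) → k)
    parameter = toUnaryR ∘R sndR ∘R fstR

-- The interval representation

lefts : ℕ → Item → Fin 3 → ℕ
lefts N u zero             = left₀ N u
lefts N u (suc zero)       = left₁ N u
lefts N u (suc (suc zero)) = left₂ N u

rights : ℕ → Item → Fin 3 → ℕ
rights N u r = lefts N u r + span N u

Meet : ℕ → Item → Item → Set
Meet N u v = ∃ λ r → lefts N u r ≤ rights N v r × lefts N v r ≤ rights N u r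

meet-sym : ∀ {N u v} → Meet N u v → Meet N v u
meet-sym (r , p , q) = r , q , p

-- Points have span 0 and distinct positions on every track; the bounds by `N` make the subtraction
-- on the reversed track injective.
points-apart : ∀ {N s t} K K′ → s ≤ N → t ≤ N →
               Meet N (s , false , K) (t , false , K′) → s ≡ t
points-apart {N} {s} {t} K K′ s≤N t≤N (r , p , q) = go r p q
  where
  antisym : ∀ {x y} → x ≤ y + 0 → y ≤ x + 0 → x ≡ y
  antisym {x} {y} x≤y y≤x = ≤-antisym (subst (x ≤_) (+-identityʳ y) x≤y) (subst (y ≤_) (+-identityʳ x) y≤x)
  go : ∀ r → lefts N (s , false , K) r ≤ rights N (t , false , K′) r →
       lefts N (t , false , K′) r ≤ rights N (s , false , K) r → s ≡ t
  go zero             p q = ∸-cancelˡ-≡ s≤N t≤N (antisym p q)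
  go (suc zero)       p q = *-cancelˡ-≡ s t (2 + N) (antisym p q)
  go (suc (suc zero)) p q = antisym p q

-- On the first track every pair starts no later than `suc N` and, as its span is at least `N`, ends
-- no earlier.
pairs-meet : ∀ {N} s t K K′ → Meet N (s , true , K) (t , true , K′)
pairs-meet {N} s t K K′ = zero , reach s K t K′ , reach t K′ s K
  where
  reach : ∀ s K t K′ → lefts N (s , true , K) zero ≤ rights N (t , true , K′) zero
  reach s (i , j) t (i′ , j′) = s≤s (≤-trans (m∸n≤m N (i ⊓ j))
    (≤-trans (m≤n+m N _) (m≤n+m _ (N ∸ (i′ ⊓ j′)))))

⊓-⊔-choice : ∀ {t} i j → (t ≡ i ⊎ t ≡ j) ⇔ (t ≡ i ⊓ j ⊎ t ≡ i ⊔ j)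
⊓-⊔-choice i j with ≤-total i j
... | inj₁ i≤j rewrite m≤n⇒m⊓n≡m i≤j | m≤n⇒m⊔n≡n i≤j = mk⇔ (λ e → e) (λ e → e)
... | inj₂ j≤i rewrite m≥n⇒m⊓n≡n j≤i | m≥n⇒m⊔n≡m j≤i = mk⇔ Sum.swap Sum.swap

module _ {N : ℕ} (s : ℕ) {i j : ℕ} (K : ℕ × ℕ) (t : ℕ) where

  private
    a b e M : ℕ
    a = i ⊓ j
    b = i ⊔ j
    e = b ∸ suc a
    M = 2 + N

    a≤b : a ≤ b
    a≤b = m⊓n≤m⊔n i j

    absurd : ∀ {A : Set} {x y} → x ≤ y → suc y ≤ x → A
    absurd x≤y y<x = ⊥-elim (<-irrefl refl (≤-trans y<x x≤y))

    -- With `b` equal to `a + e + 1`, the interval on the second track ends at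
    -- `M * (a + e) + N + 1`. Since `M` is `2 + N`, this is one unit before the point `b`.
    last : a < b → suc (M * a) + (M * e + N) < M * b
    last a<b = begin-strict
      suc (M * a) + (M * e + N)   <⟨ ≤-reflexive (shape N (M * a) (M * e)) ⟩
      M + (M * a + M * e)         ≡⟨ cong (λ x → M + x) (sym (*-distribˡ-+ M a e)) ⟩
      M + M * (a + e)             ≡⟨ sym (*-suc M (a + e)) ⟩
      M * suc (a + e)             ≡⟨ cong (M *_) (m+[n∸m]≡n a<b) ⟩
      M * b                       ∎
      where
      open ≤-Reasoning
      shape : ∀ N x y → suc (suc x + (y + N)) ≡ 2 + N + (x + y)
      shape = solve-∀

  -- On every track an endpoint lies before the interval of the pair, except that on the second
  -- track `b` lies after it when `a < b`.
  endpoint-misses : t ≡ i ⊎ t ≡ j → ¬ Meet N (t , false , K) (s , true , i , j)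
  endpoint-misses t∈ (r , p , q) = misses r (Equivalence.to (⊓-⊔-choice i j) t∈) p q
    where
    drop0 : ∀ {x y} → x ≤ y + 0 → x ≤ y
    drop0 {x} {y} = subst (x ≤_) (+-identityʳ y)
    misses : ∀ r → t ≡ a ⊎ t ≡ b → lefts N (t , false , K) r ≤ rights N (s , true , i , j) r →
             ¬ lefts N (s , true , i , j) r ≤ rights N (t , false , K) r
    misses zero             (inj₁ refl) p q = absurd ≤-refl (drop0 q)
    misses zero             (inj₂ refl) p q = absurd (∸-monoʳ-≤ N a≤b) (drop0 q)
    misses (suc zero)       (inj₁ refl) p q = absurd ≤-refl (drop0 q)
    misses (suc zero)       (inj₂ refl) p q with m≤n⇒m<n∨m≡n a≤b
    ... | inj₁ a<b = absurd p (last a<b)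
    ... | inj₂ a≡b = absurd (≤-reflexive (cong (M *_) (sym a≡b))) (drop0 q)
    misses (suc (suc zero)) (inj₁ refl) p q = absurd a≤b (drop0 q)
    misses (suc (suc zero)) (inj₂ refl) p q = absurd ≤-refl (drop0 q)

  -- The track is the first for `t < a`, the second for `t` strictly between `a` and `b`, and the
  -- third for `t > b`. On the outer tracks points sit at positions at most `N`, which a span of at
  -- least `N` always reaches.
  other-meets : a ≤ N → t ≤ N → t ≢ i → t ≢ j → Meet N (t , false , K) (s , true , i , j)
  other-meets a≤N t≤N t≢i t≢j with <-cmp t a | <-cmp t b
  ... | tri≈ _ t≡a _ | _ = ⊥-elim (Sum.[ t≢i , t≢j ] (Equivalence.from (⊓-⊔-choice i j) (inj₁ t≡a)))
  ... | _ | tri≈ _ t≡b _ = ⊥-elim (Sum.[ t≢i , t≢j ] (Equivalence.from (⊓-⊔-choice i j) (inj₂ t≡b)))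
  ... | tri< t<a _ _ | _ = zero
    , ≤-trans (m∸n≤m N t) (≤-trans (m≤n+m N (M * e)) (m≤n+m _ (suc (N ∸ a))))
    , ≤-trans (∸-monoʳ-< t<a a≤N) (m≤m+n _ 0)
  ... | tri> _ _ a<t | tri< t<b _ _ = suc zero
    , (begin
        M * t                     ≤⟨ *-monoʳ-≤ M (s≤s⁻¹ (≤-trans t<b
                                       (≤-reflexive (sym (m+[n∸m]≡n (<-trans a<t t<b)))))) ⟩
        M * (a + e)               ≡⟨ *-distribˡ-+ M a e ⟩
        M * a + M * e             ≤⟨ +-mono-≤ (n≤1+n (M * a)) (m≤m+n (M * e) N) ⟩
        suc (M * a) + (M * e + N) ∎)
    , (begin
        suc (M * a) ≤⟨ +-monoˡ-≤ (M * a) (s≤s (z≤n {suc N})) ⟩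
        M + M * a   ≡⟨ sym (*-suc M a) ⟩
        M * suc a   ≤⟨ *-monoʳ-≤ M a<t ⟩
        M * t       ≡⟨ sym (+-identityʳ _) ⟩
        M * t + 0   ∎)
    where open ≤-Reasoning
  ... | tri> _ _ _ | tri> _ _ b<t = suc (suc zero)
    , ≤-trans t≤N (≤-trans (m≤n+m N (M * e)) (m≤n+m _ (suc b)))
    , ≤-trans b<t (m≤m+n t 0)

-- The bound on `i` also bounds `i ⊓ j`, so no subtraction from `N` on the first track truncates.
Bounded : ℕ → Item → Set
Bounded N (t , a , i , j) = t ≤ N × i ≤ N

adjacent-sym : ∀ u v → adjacent u v ≡ adjacent v u
adjacent-sym (s , true , _)  (t , true , _)  = refl
adjacent-sym (s , true , _)  (t , false , _) = refl
adjacent-sym (s , false , _) (t , true , _)  = refl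
adjacent-sym (s , false , _) (t , false , _) = cong not (≡ᵇ-sym s t)
  where
  ≡ᵇ-sym : ∀ m n → (m ≡ᵇ n) ≡ (n ≡ᵇ m)
  ≡ᵇ-sym zero    zero    = refl
  ≡ᵇ-sym zero    (suc n) = refl
  ≡ᵇ-sym (suc m) zero    = refl
  ≡ᵇ-sym (suc m) (suc n) = ≡ᵇ-sym m n

adjacent-irrefl : ∀ u → adjacent u u ≡ false
adjacent-irrefl (s , true , _)  = refl
adjacent-irrefl (s , false , _) = cong not (≡ᵇ-refl s)
  where
  ≡ᵇ-refl : ∀ m → (m ≡ᵇ m) ≡ true
  ≡ᵇ-refl zero    = refl
  ≡ᵇ-refl (suc m) = ≡ᵇ-refl m

T-not : ∀ {b} → T (not b) ⇔ (¬ T b)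
T-not {true}  = mk⇔ (λ ()) (λ ¬t → ¬t _)
T-not {false} = mk⇔ (λ _ ()) _

endpoint : ∀ t i j → T ((t ≡ᵇ i) ∨ (t ≡ᵇ j)) ⇔ (t ≡ i ⊎ t ≡ j)
endpoint t i j = mk⇔
  (Sum.map (≡ᵇ⇒≡ t i) (≡ᵇ⇒≡ t j) ∘ Equivalence.to T-∨)
  (Equivalence.from T-∨ ∘ Sum.map (≡⇒≡ᵇ t i) (≡⇒≡ᵇ t j))

adjacent-meet : ∀ {N} u v → Bounded N u → Bounded N v → proj₁ u ≢ proj₁ v →
                (¬ T (adjacent u v)) ⇔ Meet N u v
adjacent-meet (s , true , K) (t , true , K′) _ _ _ =
  mk⇔ (λ _ → pairs-meet s t K K′) (λ _ ())
adjacent-meet (s , false , K) (t , false , K′) (s≤N , _) (t≤N , _) s≢t =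
  mk⇔ (λ ¬adj → ⊥-elim (¬adj (Equivalence.from T-not (s≢t ∘ ≡ᵇ⇒≡ s t))))
      (λ meet → ⊥-elim (s≢t (points-apart K K′ s≤N t≤N meet)))
adjacent-meet (t , false , K) (s , true , i , j) (t≤N , _) (_ , i≤N) _ =
  mk⇔ (λ ¬adj → other-meets s K t (≤-trans (m⊓n≤m i j) i≤N) t≤N
                  (¬adj ∘ Equivalence.from (endpoint t i j) ∘ inj₁)
                  (¬adj ∘ Equivalence.from (endpoint t i j) ∘ inj₂))
      (λ meet adj → endpoint-misses s K t (Equivalence.to (endpoint t i j) adj) meet)
adjacent-meet u@(s , true , i , j) v@(t , false , K) u≤ v≤ s≢t =
  mk⇔ (meet-sym ∘ Equivalence.to (adjacent-meet v u v≤ u≤ (s≢t ∘ sym)))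
      (Equivalence.from (adjacent-meet v u v≤ u≤ (s≢t ∘ sym)) ∘ meet-sym)

-- Given directly in lowest terms, so that its encoding computes to the tree used for `ratᴰ`.
fromNat : ℕ → ℚ
fromNat n = mkℚ (ℤ.+ n) 0 (Coprimality.sym (Coprimality.1-coprimeTo n))

fromNat-mono : ∀ {m n} → m ≤ n → fromNat m ℚ.≤ fromNat n
fromNat-mono m≤n = ℚ.*≤* (ℤ.*-monoʳ-≤-nonNeg (ℤ.+ 1) (ℤ.+≤+ m≤n))

fromNat-cancel : ∀ {m n} → fromNat m ℚ.≤ fromNat n → m ≤ n
fromNat-cancel (ℚ.*≤* p) = ℤ.drop‿+≤+ (ℤ.*-cancelʳ-≤-pos _ _ (ℤ.+ 1) p)

fromNat-+ : ∀ m n → fromNat (m + n) ≡ fromNat m ℚ.+ fromNat n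
fromNat-+ m n = ℚ.toℚᵘ-injective (ℚᵘ.≃-trans
  (ℚᵘ.*≡* (cong (ℤ._* ℤ.+ 1) (sym (cong₂ ℤ._+_ (ℤ.*-identityʳ (ℤ.+ m)) (ℤ.*-identityʳ (ℤ.+ n))))))
  (ℚᵘ.≃-sym (ℚ.toℚᵘ-homo-+ (fromNat m) (fromNat n))))

fromNat-length : ∀ m n → fromNat (m + n) ℚ.- fromNat m ≡ fromNat n
fromNat-length m n = begin
  fromNat (m + n) ℚ.- fromNat m
    ≡⟨ cong (ℚ._- fromNat m) (trans (cong fromNat (+-comm m n)) (fromNat-+ n m)) ⟩
  fromNat n ℚ.+ fromNat m ℚ.- fromNat m
    ≡⟨ ℚ.+-assoc (fromNat n) (fromNat m) (ℚ.- fromNat m) ⟩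
  fromNat n ℚ.+ (fromNat m ℚ.- fromNat m)
    ≡⟨ cong (fromNat n ℚ.+_) (ℚ.+-inverseʳ (fromNat m)) ⟩
  fromNat n ℚ.+ ℚ.0ℚ
    ≡⟨ ℚ.+-identityʳ (fromNat n) ⟩
  fromNat n
    ∎
  where open ≡-Reasoning

itemIntervals : ℕ → Item → 3-TrackInterval
itemIntervals N u r = record
  { left       = fromNat (lefts N u r)
  ; right      = fromNat (rights N u r)
  ; left≤right = fromNat-mono (m≤m+n _ _)
  }

itemIntervals-balanced : ∀ N u → Balanced (itemIntervals N u)
itemIntervals-balanced N u r r′ =
  trans (fromNat-length (lefts N u r) (span N u)) (sym (fromNat-length (lefts N u r′) (span N u)))

meet-intersect : ∀ N u v → Meet N u v ⇔ (points (itemIntervals N u) ≬ points (itemIntervals N v))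
meet-intersect N u v = mk⇔
  -- The larger of the two left ends lies in both intervals.
  (λ (r , p , q) → (r , fromNat (lefts N u r ⊔ lefts N v r))
    , (fromNat-mono (m≤m⊔n _ _) , fromNat-mono (⊔-lub (m≤m+n _ _) q))
    , (fromNat-mono (m≤n⊔m _ _) , fromNat-mono (⊔-lub p (m≤m+n _ _))))
  (λ ((r , _) , (a , b) , (c , d)) →
    r , fromNat-cancel (ℚ.≤-trans a d) , fromNat-cancel (ℚ.≤-trans c b))

module _ {N : ℕ} (item : Fin N → Item)
         (item-position : ∀ u → proj₁ (item u) ≡ toℕ u)
         (item-bounded : ∀ u → Bounded N (item u)) where

  itemGraph : Graph N
  itemGraph = record
    { edge        = λ u v → adjacent (item u) (item v)
    ; symmetric   = λ u v → adjacent-sym (item u) (item v)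
    ; irreflexive = λ u → adjacent-irrefl (item u)
    }

  itemRepresentation : Balanced3TrackRepresentation (complement itemGraph)
  itemRepresentation = record
    { family     = λ u → itemIntervals N (item u)
    ; balanced   = λ u → itemIntervals-balanced N (item u)
    ; represents = λ u v → mk⇔ (intersect u v) (λ (u≢v , meet) → non-adjacent u v u≢v meet)
    }
    where
    apart : ∀ {u v} → u ≢ v → proj₁ (item u) ≢ proj₁ (item v)
    apart {u} {v} u≢v eq = u≢v (toℕ-injective (trans (sym (item-position u)) (trans eq (item-position v))))

    nonadjacent⇔meet : ∀ u v → u ≢ v → (¬ T (adjacent (item u) (item v))) ⇔ Meet N (item u) (item v)
    nonadjacent⇔meet u v u≢v = adjacent-meet (item u) (item v) (item-bounded u) (item-bounded v) (apart u≢v)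

    intersect : ∀ u v → Adjacent (complement itemGraph) u v →
                u ≢ v × points (itemIntervals N (item u)) ≬ points (itemIntervals N (item v))
    intersect u v adj with Equivalence.to T-∧ adj
    ... | ¬edge , ¬same = u≢v , Equivalence.to (meet-intersect N (item u) (item v))
                                  (Equivalence.to (nonadjacent⇔meet u v u≢v) (Equivalence.to T-not ¬edge))
      where
      u≢v : u ≢ v
      u≢v u≡v = Equivalence.to T-not ¬same (fromWitness u≡v)

    non-adjacent : ∀ u v → u ≢ v → points (itemIntervals N (item u)) ≬ points (itemIntervals N (item v)) →
                   Adjacent (complement itemGraph) u v
    non-adjacent u v u≢v meet = Equivalence.from T-∧
      ( Equivalence.from T-not (Equivalence.from (nonadjacent⇔meet u v u≢v)
          (Equivalence.from (meet-intersect N (item u) (item v)) meet))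
      , Equivalence.from T-not (λ same → u≢v (toWitness same)))

-- Cliques and separations

∣++∣ : ∀ {m n} (p : Subset m) (q : Subset n) → ∣ p ++ᵛ q ∣ ≡ ∣ p ∣ + ∣ q ∣
∣++∣ []          q = refl
∣++∣ (true ∷ p)  q = cong suc (∣++∣ p q)
∣++∣ (false ∷ p) q = ∣++∣ p q

∣p∪q∣≤∣p∣+∣q∣ : ∀ {n} (p q : Subset n) → ∣ p ∪ q ∣ ≤ ∣ p ∣ + ∣ q ∣
∣p∪q∣≤∣p∣+∣q∣ []          []          = z≤n
∣p∪q∣≤∣p∣+∣q∣ (true ∷ p)  (true ∷ q)  = s≤s (≤-trans (∣p∪q∣≤∣p∣+∣q∣ p q) (+-monoʳ-≤ ∣ p ∣ (n≤1+n _)))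
∣p∪q∣≤∣p∣+∣q∣ (true ∷ p)  (false ∷ q) = s≤s (∣p∪q∣≤∣p∣+∣q∣ p q)
∣p∪q∣≤∣p∣+∣q∣ (false ∷ p) (true ∷ q)  = ≤-trans (s≤s (∣p∪q∣≤∣p∣+∣q∣ p q))
                                                (≤-reflexive (sym (+-suc ∣ p ∣ ∣ q ∣)))
∣p∪q∣≤∣p∣+∣q∣ (false ∷ p) (false ∷ q) = ∣p∪q∣≤∣p∣+∣q∣ p q

⊆∧∣≡∣⇒⊇ : ∀ {n} {p q : Subset n} → p ⊆ q → ∣ p ∣ ≡ ∣ q ∣ → q ⊆ p
⊆∧∣≡∣⇒⊇ {p = p} p⊆q eq {x} x∈q with x ∈? p
... | yes x∈p = x∈p
... | no  x∉p = ⊥-elim (<-irrefl eq (p⊂q⇒∣p∣<∣q∣ (p⊆q , x , x∈q , x∉p)))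

module _ {n : ℕ} (C : Subset n) where

  -- The 0-1 matrix of a product of two sets. Its concatenation lists the entries row by row, in the
  -- order in which `combine` numbers the pairs.
  squareRows : ∀ {m} → Subset m → Vec (Subset n) m
  squareRows = Vec.map (λ b → ifᵇ b then C else Subset.⊥)

  ∣squareRows∣ : ∀ {m} (B : Subset m) → ∣ concat (squareRows B) ∣ ≡ ∣ B ∣ * ∣ C ∣
  ∣squareRows∣ []          = refl
  ∣squareRows∣ (true ∷ B)  = trans (∣++∣ C _) (cong (∣ C ∣ +_) (∣squareRows∣ B))
  ∣squareRows∣ (false ∷ B) = trans (∣++∣ (Subset.⊥ {n}) _)
    (trans (cong (_+ ∣ concat (squareRows B) ∣) (∣⊥∣≡0 n)) (∣squareRows∣ B))

module Reduction {n : ℕ} (G : Graph n) (k : ℕ) where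

  D N : ℕ
  D = suc k * suc k
  N = n + (n * n + D)

  -- The common layout of all data on the vertices of `H`: vertices of `G`, ordered pairs row by
  -- row, dummies.
  assemble : ∀ {A : Set} → Vec A n → Vec (Vec A n) n → Vec A D → Vec A N
  assemble xs xss ys = xs ++ᵛ (concat xss ++ᵛ ys)

  vertex : Fin n → Fin N
  vertex i = i ↑ˡ (n * n + D)

  pair : Fin n → Fin n → Fin N
  pair i j = n ↑ʳ (combine i j ↑ˡ D)

  dummy : Fin D → Fin N
  dummy d = n ↑ʳ (n * n ↑ʳ d)

  data View : Fin N → Set where
    is-vertex : ∀ i → View (vertex i)
    is-pair   : ∀ i j → View (pair i j)
    is-dummy  : ∀ d → View (dummy d)

  view : ∀ u → View u
  view u with splitAt n u in eq
  ... | inj₁ i = subst View (splitAt⁻¹-↑ˡ eq) (is-vertex i)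
  ... | inj₂ v with splitAt (n * n) v in eq′
  ...   | inj₂ d = subst View (trans (cong (n ↑ʳ_) (splitAt⁻¹-↑ʳ eq′)) (splitAt⁻¹-↑ʳ eq)) (is-dummy d)
  ...   | inj₁ p with combine-surjective {n} {n} p
  ...     | i , j , refl = subst View (trans (cong (n ↑ʳ_) (splitAt⁻¹-↑ˡ eq′)) (splitAt⁻¹-↑ʳ eq)) (is-pair i j)

  module _ {A : Set} (xs : Vec A n) (xss : Vec (Vec A n) n) (ys : Vec A D) where

    lookup-vertex : ∀ i → lookup (assemble xs xss ys) (vertex i) ≡ lookup xs i
    lookup-vertex i = lookup-++ˡ xs _ i

    lookup-pair : ∀ i j → lookup (assemble xs xss ys) (pair i j) ≡ lookup (lookup xss i) j
    lookup-pair i j = trans (lookup-++ʳ xs _ _)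
      (trans (lookup-++ˡ (concat xss) ys _) (lookup-concat xss i j))

    lookup-dummy : ∀ d → lookup (assemble xs xss ys) (dummy d) ≡ lookup ys d
    lookup-dummy d = trans (lookup-++ʳ xs _ _) (lookup-++ʳ (concat xss) ys d)

  pairKind : Fin n → Fin n → Kind
  pairKind i j = (edge G i j ∨ (toℕ i ≡ᵇ toℕ j)) , toℕ i , toℕ j

  pairKinds : Vec (Vec Kind n) n
  pairKinds = tabulate λ i → tabulate (pairKind i)

  kindVec : Vec Kind N
  kindVec = assemble (replicate n point) pairKinds (replicate D point)

  kind : Fin N → Kind
  kind = lookup kindVec

  kind-vertex : ∀ i → kind (vertex i) ≡ point
  kind-vertex i = trans (lookup-vertex (replicate n point) pairKinds (replicate D point) i)
                        (lookup-replicate i _)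

  kind-dummy : ∀ d → kind (dummy d) ≡ point
  kind-dummy d = trans (lookup-dummy (replicate n point) pairKinds (replicate D point) d)
                       (lookup-replicate d _)

  kind-pair : ∀ i j → kind (pair i j) ≡ pairKind i j
  kind-pair i j = trans (lookup-pair (replicate n point) pairKinds (replicate D point) i j)
    (trans (cong (λ v → lookup v j) (lookup∘tabulate (λ i → tabulate (pairKind i)) i))
           (lookup∘tabulate (pairKind i) j))

  item : Fin N → Item
  item u = toℕ u , kind u

  item-bounded : ∀ u → Bounded N (item u)
  item-bounded u = <⇒≤ (toℕ<n u) , first≤ u (view u)
    where
    first≤ : ∀ u → View u → proj₁ (proj₂ (kind u)) ≤ N
    first≤ _ (is-vertex i) rewrite kind-vertex i = z≤n
    first≤ _ (is-dummy d)  rewrite kind-dummy d = z≤n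
    first≤ _ (is-pair i j) rewrite kind-pair i j = ≤-trans (<⇒≤ (toℕ<n i)) (m≤m+n n _)

  H : Graph N
  H = itemGraph item (λ _ → refl) item-bounded

  IsPoint : Fin N → Set
  IsPoint u = proj₁ (kind u) ≡ false

  -- Unlike `View`, this sorts by the role in `H`: an ordered pair that is neither adjacent nor
  -- equal counts as a point.
  data Shape (u : Fin N) : Set where
    a-point : IsPoint u → Shape u
    a-pair  : ∀ i j → u ≡ pair i j → kind u ≡ (true , toℕ i , toℕ j) → Shape u

  shape : ∀ u → Shape u
  shape u with view u
  ... | is-vertex i = a-point (cong proj₁ (kind-vertex i))
  ... | is-dummy d  = a-point (cong proj₁ (kind-dummy d))
  ... | is-pair i j with edge G i j ∨ (toℕ i ≡ᵇ toℕ j) in eq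
  ...   | true  = a-pair i j refl (trans (kind-pair i j) (cong (_, _) eq))
  ...   | false = a-point (trans (cong proj₁ (kind-pair i j)) eq)

  points-adjacent : ∀ {u v} → IsPoint u → IsPoint v → u ≢ v → Adjacent H u v
  points-adjacent {u} {v} p q u≢v with kind u | kind v
  ... | false , _ | false , _ = Equivalence.from T-not (u≢v ∘ toℕ-injective ∘ ≡ᵇ⇒≡ (toℕ u) (toℕ v))

  pair-vertex-adjacent : ∀ {u v i j} → kind u ≡ (true , i , j) → IsPoint v →
                         Adjacent H u v ⇔ (toℕ v ≡ i ⊎ toℕ v ≡ j)
  pair-vertex-adjacent {u} {v} {i} {j} p q with kind u | kind v
  pair-vertex-adjacent {u} {v} {i} {j} refl refl | _ | _ = endpoint (toℕ v) i j

  pairs-non-adjacent : ∀ {u v K K′} → kind u ≡ (true , K) → kind v ≡ (true , K′) → ¬ Adjacent H u v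
  pairs-non-adjacent {u} {v} p q with kind u | kind v
  pairs-non-adjacent refl refl | _ | _ = λ ()

  toℕ-vertex : ∀ {v} i → toℕ v ≡ toℕ i → v ≡ vertex i
  toℕ-vertex i eq = toℕ-injective (trans eq (sym (toℕ-↑ˡ i _)))

  module _ (C : Subset n) where

    square : Subset N
    square = assemble Subset.⊥ (squareRows C C) Subset.⊥

    ∣square∣ : ∣ square ∣ ≡ ∣ C ∣ * ∣ C ∣
    ∣square∣ = begin
      ∣ square ∣
        ≡⟨ ∣++∣ (Subset.⊥ {n}) _ ⟩
      ∣ Subset.⊥ {n} ∣ + ∣ concat (squareRows C C) ++ᵛ Subset.⊥ ∣
        ≡⟨ cong₂ _+_ (∣⊥∣≡0 n) (∣++∣ (concat (squareRows C C)) Subset.⊥) ⟩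
      ∣ concat (squareRows C C) ∣ + ∣ Subset.⊥ {D} ∣
        ≡⟨ cong₂ _+_ (∣squareRows∣ C C) (∣⊥∣≡0 D) ⟩
      ∣ C ∣ * ∣ C ∣ + 0
        ≡⟨ +-identityʳ _ ⟩
      ∣ C ∣ * ∣ C ∣
        ∎
      where open ≡-Reasoning

    pair-row : ∀ i j → lookup square (pair i j) ≡ lookup (ifᵇ lookup C i then C else Subset.⊥) j
    pair-row i j = trans (lookup-pair Subset.⊥ (squareRows C C) Subset.⊥ i j)
      (cong (λ row → lookup row j) (lookup-map i _ C))

    pair∈square : ∀ {i j} → i ∈ C → j ∈ C → pair i j ∈ square
    pair∈square {i} {j} i∈C j∈C = lookup⇒[]= (pair i j) square (trans (pair-row i j)
      (trans (cong (λ b → lookup (ifᵇ b then C else Subset.⊥) j) ([]=⇒lookup i∈C)) ([]=⇒lookup j∈C)))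

    ∈square : ∀ {u} → u ∈ square → ∃₂ λ i j → u ≡ pair i j × i ∈ C × j ∈ C
    ∈square {u} u∈ with view u
    ... | is-vertex i = ⊥-elim (∉⊥ (lookup⇒[]= i Subset.⊥
            (trans (sym (lookup-vertex Subset.⊥ (squareRows C C) Subset.⊥ i)) ([]=⇒lookup u∈))))
    ... | is-dummy d  = ⊥-elim (∉⊥ (lookup⇒[]= d Subset.⊥
            (trans (sym (lookup-dummy Subset.⊥ (squareRows C C) Subset.⊥ d)) ([]=⇒lookup u∈))))
    ... | is-pair i j with lookup C i in eq | trans (sym (pair-row i j)) ([]=⇒lookup u∈)
    ...   | true  | j∈ = i , j , refl , lookup⇒[]= i C eq , lookup⇒[]= j C j∈
    ...   | false | j∈ = ⊥-elim (∉⊥ (lookup⇒[]= j Subset.⊥ j∈))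

    vertices : Subset N
    vertices = C ++ᵛ Subset.⊥

    ∣vertices∣ : ∣ vertices ∣ ≡ ∣ C ∣
    ∣vertices∣ = trans (∣++∣ C Subset.⊥) (trans (cong (∣ C ∣ +_) (∣⊥∣≡0 (n * n + D))) (+-identityʳ _))

    vertex∈vertices : ∀ {i} → i ∈ C → vertex i ∈ vertices
    vertex∈vertices {i} i∈C = lookup⇒[]= (vertex i) vertices (trans (lookup-++ˡ C Subset.⊥ i) ([]=⇒lookup i∈C))

    pair∉vertices : ∀ i j → pair i j ∉ vertices
    pair∉vertices i j p = ∉⊥ (lookup⇒[]= (combine i j ↑ˡ D) Subset.⊥
      (trans (sym (lookup-++ʳ C Subset.⊥ (combine i j ↑ˡ D))) ([]=⇒lookup p)))

  dummies : Subset N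
  dummies = Subset.⊥ {n} ++ᵛ (Subset.⊥ {n * n} ++ᵛ Subset.⊤ {D})

  ∣dummies∣ : ∣ dummies ∣ ≡ D
  ∣dummies∣ = begin
    ∣ dummies ∣
      ≡⟨ ∣++∣ (Subset.⊥ {n}) _ ⟩
    ∣ Subset.⊥ {n} ∣ + ∣ Subset.⊥ {n * n} ++ᵛ Subset.⊤ {D} ∣
      ≡⟨ cong₂ _+_ (∣⊥∣≡0 n) (∣++∣ (Subset.⊥ {n * n}) _) ⟩
    ∣ Subset.⊥ {n * n} ∣ + ∣ Subset.⊤ {D} ∣
      ≡⟨ cong₂ _+_ (∣⊥∣≡0 (n * n)) (∣⊤∣≡n D) ⟩
    D
      ∎
    where open ≡-Reasoning

  ∈dummies : ∀ {u} → u ∈ dummies → IsPoint u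
  ∈dummies {u} u∈ with view u
  ... | is-vertex i = cong proj₁ (kind-vertex i)
  ... | is-dummy d  = cong proj₁ (kind-dummy d)
  ... | is-pair i j = ⊥-elim (∉⊥ (lookup⇒[]= (combine i j) Subset.⊥ (trans
          (sym (trans (lookup-++ʳ (Subset.⊥ {n}) _ (combine i j ↑ˡ D)) (lookup-++ˡ Subset.⊥ Subset.⊤ (combine i j))))
          ([]=⇒lookup u∈))))

  disjoint : ∀ {m} {p q : Subset m} → (∀ {u} → u ∈ p → u ∉ q) → p ∩ q ≡ Subset.⊥
  disjoint {p = p} {q} h = Empty-unique λ (u , u∈) → h (proj₁ (x∈p∩q⁻ p q u∈)) (proj₂ (x∈p∩q⁻ p q u∈))

  clique⇒separation : HasClique G k → Separation H k (k * k)
  clique⇒separation (C , ∣C∣≡k , clique) = record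
    { X       = X
    ; S       = S
    ; Y       = ∁ (X ∪ S)
    ; cover   = trans (sym (∪-assoc X S _)) (p∪∁p≡⊤ (X ∪ S))
    ; X∩S     = disjoint X∌S
    ; X∩Y     = disjoint λ u∈X u∈Y → x∈∁p⇒x∉p u∈Y (x∈p∪q⁺ (inj₁ u∈X))
    ; S∩Y     = disjoint λ u∈S u∈Y → x∈∁p⇒x∉p u∈Y (x∈p∪q⁺ {p = X} (inj₂ u∈S))
    ; ∣X∣≡l   = trans (∣square∣ C) (cong₂ _*_ ∣C∣≡k ∣C∣≡k)
    ; ∣S∣≤k   = ≤-reflexive (trans (∣vertices∣ C) ∣C∣≡k)
    ; no-edge = no-edge′
    }
    where
    X S : Subset N
    X = square C
    S = vertices C

    X∌S : ∀ {u} → u ∈ X → u ∉ S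
    X∌S u∈X u∈S with ∈square C u∈X
    ... | i , j , refl , _ = pair∉vertices C i j u∈S

    adjacent-or-equal : ∀ {i j} → i ∈ C → j ∈ C → edge G i j ∨ (toℕ i ≡ᵇ toℕ j) ≡ true
    adjacent-or-equal {i} {j} i∈C j∈C with i ≟ j
    ... | yes i≡j = Equivalence.to T-≡ (Equivalence.from T-∨ (inj₂ (≡⇒≡ᵇ _ _ (cong toℕ i≡j))))
    ... | no  i≢j = Equivalence.to T-≡ (Equivalence.from T-∨ (inj₁ (clique i j i∈C j∈C i≢j)))

    kind-in-X : ∀ {i j} → i ∈ C → j ∈ C → kind (pair i j) ≡ (true , toℕ i , toℕ j)
    kind-in-X {i} {j} i∈C j∈C =
      trans (kind-pair i j) (cong (_, (toℕ i , toℕ j)) (adjacent-or-equal i∈C j∈C))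

    -- The only neighbours of a pair over `C` are the points at its two endpoints, and these belong
    -- to `S`.
    no-edge′ : ∀ u v → u ∈ X → v ∈ ∁ (X ∪ S) → ¬ Adjacent H u v
    no-edge′ u v u∈X v∈Y adj with ∈square C u∈X
    ... | i , j , refl , i∈C , j∈C with shape v
    ...   | a-pair _ _ _ kind-v =
      pairs-non-adjacent {pair i j} {v} (kind-in-X i∈C j∈C) kind-v adj
    ...   | a-point pt = x∈∁p⇒x∉p v∈Y (x∈p∪q⁺ {p = X} (inj₂ (v∈S
      (Equivalence.to (pair-vertex-adjacent {pair i j} {v} (kind-in-X i∈C j∈C) pt) adj))))
      where
      v∈S : toℕ v ≡ toℕ i ⊎ toℕ v ≡ toℕ j → v ∈ S
      v∈S (inj₁ eq) = subst (_∈ S) (sym (toℕ-vertex i eq)) (vertex∈vertices C i∈C)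
      v∈S (inj₂ eq) = subst (_∈ S) (sym (toℕ-vertex j eq)) (vertex∈vertices C j∈C)

  separation⇒clique : Separation H k (k * k) → HasClique G k
  separation⇒clique sep = C , ∣C∣≡k , clique
    where
    open Separation sep

    -- `S` may contain pairs and dummies as well; its first `n` coordinates are its vertices of `G`.
    C : Subset n
    C = take n S

    vertex∈C : ∀ {i} → vertex i ∈ S → i ∈ C
    vertex∈C {i} v∈S = lookup⇒[]= i C (trans (sym (lookup-++ˡ C (drop n S) i))
      (trans (cong (λ p → lookup p (vertex i)) (take++drop≡id n S)) ([]=⇒lookup v∈S)))

    ∣C∣≤k : ∣ C ∣ ≤ k
    ∣C∣≤k = begin
      ∣ C ∣                ≤⟨ m≤m+n _ _ ⟩
      ∣ C ∣ + ∣ drop n S ∣ ≡⟨ sym (∣++∣ C (drop n S)) ⟩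
      ∣ C ++ᵛ drop n S ∣    ≡⟨ cong ∣_∣ (take++drop≡id n S) ⟩
      ∣ S ∣                ≤⟨ ∣S∣≤k ⟩
      k                    ∎
      where open ≤-Reasoning

    not-in-Y : ∀ {u v} → u ∈ X → Adjacent H u v → v ∈ X ⊎ v ∈ S
    not-in-Y {u} {v} u∈X adj with x∈p∪q⁻ X (S ∪ Y) (subst (v ∈_) (sym cover) ∈⊤)
    ... | inj₁ v∈X = inj₁ v∈X
    ... | inj₂ v∈SY with x∈p∪q⁻ S Y v∈SY
    ...   | inj₁ v∈S = inj₂ v∈S
    ...   | inj₂ v∈Y = ⊥-elim (no-edge u v u∈X v∈Y adj)

    -- Each dummy is equal or adjacent to a given point of `X` and hence lies in `X ∪ S`. But the
    -- square of `suc k` exceeds `k * k + k`.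
    no-point : ∀ {u} → u ∈ X → ¬ IsPoint u
    no-point {u} u∈X pt = <-irrefl refl (begin-strict
      ∣ X ∪ S ∣         ≤⟨ ∣p∪q∣≤∣p∣+∣q∣ X S ⟩
      ∣ X ∣ + ∣ S ∣     ≤⟨ +-mono-≤ (≤-reflexive ∣X∣≡l) ∣S∣≤k ⟩
      k * k + k         <⟨ s≤s (m≤m+n (k * k + k) k) ⟩
      suc (k * k + k + k) ≡⟨ expand k ⟩
      D                 ≡⟨ sym ∣dummies∣ ⟩
      ∣ dummies ∣       ≤⟨ p⊆q⇒∣p∣≤∣q∣ dummies⊆ ⟩
      ∣ X ∪ S ∣         ∎)
      where
      open ≤-Reasoning
      expand : ∀ k → suc (k * k + k + k) ≡ suc k * suc k
      expand = solve-∀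
      dummies⊆ : dummies ⊆ X ∪ S
      dummies⊆ {v} v∈ with u ≟ v
      ... | yes refl = x∈p∪q⁺ (inj₁ u∈X)
      ... | no  u≢v  = x∈p∪q⁺ (not-in-Y u∈X (points-adjacent pt (∈dummies v∈) u≢v))

    -- The vertex `a` is a neighbour of `u` and so lies in `X` or in `S`; being a point, it cannot
    -- lie in `X`.
    endpoint∈C : ∀ {u i j} a → u ∈ X → kind u ≡ (true , toℕ i , toℕ j) → a ≡ i ⊎ a ≡ j → a ∈ C
    endpoint∈C {u} {i} {j} a u∈X kind-u a∈ with not-in-Y u∈X
      (Equivalence.from (pair-vertex-adjacent {u} {vertex a} kind-u (cong proj₁ (kind-vertex a)))
        (Sum.map at at a∈))
      where
      at : ∀ {b} → a ≡ b → toℕ (vertex a) ≡ toℕ b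
      at refl = toℕ-↑ˡ a _
    ... | inj₁ a∈X = ⊥-elim (no-point a∈X (cong proj₁ (kind-vertex a)))
    ... | inj₂ a∈S = vertex∈C a∈S

    X⊆square : X ⊆ square C
    X⊆square {u} u∈X with shape u
    ... | a-point pt = ⊥-elim (no-point u∈X pt)
    ... | a-pair i j refl kind-u =
      pair∈square C (endpoint∈C i u∈X kind-u (inj₁ refl)) (endpoint∈C j u∈X kind-u (inj₂ refl))

    ∣C∣≡k : ∣ C ∣ ≡ k
    ∣C∣≡k with m≤n⇒m<n∨m≡n ∣C∣≤k
    ... | inj₂ eq  = eq
    -- Fewer than `k` vertices span fewer than `k * k` ordered pairs, too few to contain `X`.
    ... | inj₁ c<k = ⊥-elim (<-irrefl refl (begin-strict
      k * k         ≡⟨ sym ∣X∣≡l ⟩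
      ∣ X ∣         ≤⟨ p⊆q⇒∣p∣≤∣q∣ X⊆square ⟩
      ∣ square C ∣  ≡⟨ ∣square∣ C ⟩
      ∣ C ∣ * ∣ C ∣ <⟨ *-mono-< c<k c<k ⟩
      k * k         ∎))
      where open ≤-Reasoning

    square⊆X : square C ⊆ X
    square⊆X = ⊆∧∣≡∣⇒⊇ X⊆square (trans ∣X∣≡l (sym (trans (∣square∣ C) (cong₂ _*_ ∣C∣≡k ∣C∣≡k))))

    clique : ∀ i j → i ∈ C → j ∈ C → i ≢ j → Adjacent G i j
    clique i j i∈C j∈C i≢j with edge G i j in eq
    ... | true  = _
    -- If distinct `i` and `j` were not adjacent, their pair would be a point, yet it lies in the
    -- square and hence in `X`.
    ... | false = no-point (square⊆X (pair∈square C i∈C j∈C))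
      (trans (cong proj₁ (kind-pair i j)) (trans (cong (_∨ (toℕ i ≡ᵇ toℕ j)) eq) (unequal (toℕ i ≡ᵇ toℕ j) refl)))
      where
      unequal : ∀ b → (toℕ i ≡ᵇ toℕ j) ≡ b → b ≡ false
      unequal false _  = refl
      unequal true  eq = ⊥-elim (i≢j (toℕ-injective (≡ᵇ⇒≡ _ _ (Equivalence.from T-≡ eq))))

-- Encodings

encodeFamily-cong : ∀ {A B : Set} {e : A → Tree} {e′ : B → Tree} {n} {f : Fin n → A} {g : Fin n → B} →
                    (∀ i → e (f i) ≡ e′ (g i)) → encodeFamily e f ≡ encodeFamily e′ g
encodeFamily-cong {n = zero}  eq = refl
encodeFamily-cong {n = suc n} eq = cong₂ _∙_ (eq zero) (encodeFamily-cong (eq ∘ suc))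

matrix : ∀ {n} → Graph n → List (List Bool)
matrix G = List.tabulate λ u → List.tabulate (edge G u)

encode-matrix : ∀ {n} (G : Graph n) → enc (listᴰ (listᴰ boolᴰ)) (matrix G) ≡ encodeGraph G
encode-matrix G = encodeFamily-cong λ _ → refl

index-tabulate : ∀ {X : Set} {n} m (f : Fin n → X) →
                 index m (List.tabulate f) ≡ List.tabulate (λ i → m + toℕ i , f i)
index-tabulate {n = zero}  m f = refl
index-tabulate {n = suc n} m f = cong₂ _∷_ (cong (_, f zero) (sym (+-identityʳ m)))
  (trans (index-tabulate (suc m) (f ∘ suc)) (tabulate-cong λ i → cong (_, f (suc i)) (sym (+-suc m (toℕ i)))))

toList-lookup : ∀ {X : Set} {n} (v : Vec X n) → Vec.toList v ≡ List.tabulate (Vec.lookup v)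
toList-lookup []      = refl
toList-lookup (x ∷ v) = cong (x ∷_) (toList-lookup v)

toList-tabulate : ∀ {X : Set} {n} (f : Fin n → X) → Vec.toList (Vec.tabulate f) ≡ List.tabulate f
toList-tabulate {n = zero}  f = refl
toList-tabulate {n = suc n} f = cong (f zero ∷_) (toList-tabulate (f ∘ suc))

concat-tabulate : ∀ {X : Set} {m n} (f : Fin n → Fin m → X) →
                  List.concat (List.tabulate λ i → List.tabulate (f i)) ≡
                  Vec.toList (Vec.concat (Vec.tabulate λ i → Vec.tabulate (f i)))
concat-tabulate {n = zero}  f = refl
concat-tabulate {n = suc n} f = begin
  List.tabulate (f zero) ++ List.concat (List.tabulate λ i → List.tabulate (f (suc i)))
    ≡⟨ cong₂ _++_ (sym (toList-tabulate (f zero))) (concat-tabulate λ i → f (suc i)) ⟩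
  Vec.toList (Vec.tabulate (f zero)) ++ Vec.toList (Vec.concat (Vec.tabulate λ i → Vec.tabulate (f (suc i))))
    ≡⟨ sym (toList-++ (Vec.tabulate (f zero)) _) ⟩
  Vec.toList (Vec.concat (Vec.tabulate λ i → Vec.tabulate (f i))) ∎
  where open ≡-Reasoning

module _ {n : ℕ} (G : Graph n) (k : ℕ) where

  open Reduction G k

  -- The program works on lists and the correctness proof on vectors; from here on both are shown to
  -- describe the same graph.
  pairs-matrix : pairs (matrix G) ≡ Vec.toList (Vec.concat pairKinds)
  pairs-matrix = begin
    List.concat (List.map row (index 0 (matrix G)))
      ≡⟨ cong (List.concat ∘ List.map row) (index-tabulate 0 (λ i → List.tabulate (edge G i))) ⟩
    List.concat (List.map row (List.tabulate (λ i → toℕ i , List.tabulate (edge G i))))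
      ≡⟨ cong List.concat (map-tabulate (λ i → toℕ i , List.tabulate (edge G i)) row) ⟩
    List.concat (List.tabulate (λ i → row (toℕ i , List.tabulate (edge G i))))
      ≡⟨ cong List.concat (tabulate-cong row-pairs) ⟩
    List.concat (List.tabulate (λ i → List.tabulate (pairKind i)))
      ≡⟨ concat-tabulate pairKind ⟩
    Vec.toList (Vec.concat pairKinds) ∎
    where
    open ≡-Reasoning
    cell : ℕ → ℕ × Bool → Kind
    cell i (j , b) = (b ∨ (i ≡ᵇ j)) , i , j
    row : ℕ × List Bool → List Kind
    row (i , bs) = List.map (cell i) (index 0 bs)
    row-pairs : ∀ i → row (toℕ i , List.tabulate (edge G i)) ≡ List.tabulate (pairKind i)
    row-pairs i = trans (cong (List.map (cell (toℕ i))) (index-tabulate 0 (edge G i)))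
                        (map-tabulate (λ j → toℕ j , edge G i j) (cell (toℕ i)))

  kinds-matrix : kinds (matrix G) k ≡ Vec.toList kindVec
  kinds-matrix = sym (begin
    Vec.toList kindVec
      ≡⟨ toList-++ (Vec.replicate n point) _ ⟩
    Vec.toList (Vec.replicate n point) ++ Vec.toList (Vec.concat pairKinds ++ᵛ Vec.replicate D point)
      ≡⟨ cong₂ _++_ (toList-replicate n point) (toList-++ (Vec.concat pairKinds) _) ⟩
    List.replicate n point ++ (Vec.toList (Vec.concat pairKinds) ++ Vec.toList (Vec.replicate D point))
      ≡⟨ cong₂ _++_ (cong (λ m → List.replicate m point) (sym (length-tabulate (λ i → List.tabulate (edge G i)))))
                    (cong₂ _++_ (sym pairs-matrix) (toList-replicate D point)) ⟩
    kinds (matrix G) k ∎)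
    where open ≡-Reasoning

  items-matrix : index 0 (kinds (matrix G) k) ≡ List.tabulate item
  items-matrix = trans (cong (index 0) (trans kinds-matrix (toList-lookup kindVec))) (index-tabulate 0 kind)

  image : SeparatingVerticesInstance
  image = record
    { H              = H
    ; representation = itemRepresentation item (λ _ → refl) item-bounded
    ; k              = k
    ; l              = k * k
    }

  reduce-matrix : reduce (matrix G , k) ≡
    (matrix H , List.tabulate (λ u → tracks N (item u)) , k , k * k)
  reduce-matrix = trans
    (cong (λ is → proj₁ (describe is) , proj₂ (describe is) , k , k * k) items-matrix)
    (cong₂ (λ M R → M , R , k , k * k)
      (trans (map-tabulate item _) (tabulate-cong λ u → map-tabulate item (adjacent (item u))))
      (trans (map-tabulate item _) (cong (λ m → List.tabulate (λ u → tracks m (item u))) (length-tabulate item))))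

  encode-reduce : enc outputᴰ (reduce (matrix G , k)) ≡
                  ParamProblem.encode k-SeparatingVertices-CoBalanced3Track image
  encode-reduce = trans (cong (enc outputᴰ) reduce-matrix) (cong₂ _∙_ (encode-matrix H)
    (cong (_∙ (encodeℕ k ∙ encodeℕ (k * k))) (encodeFamily-cong {n = N} λ _ → refl)))

-- The FPT reduction with its time and parameter bounds

program : ∀ {A B f} → Real A B f → Program
program r = record { extra = 1 ; body = cmd r }

Real⇒Computes : ∀ {A B f} (r : Real A B f) a →
                ∃ λ t → t ≤ cost r a + μ B (f a) × Computes (program r) (enc A a) (enc B (f a)) t
Real⇒Computes {A} {B} {f} r a with run r a nil
... | t , e , t≤ = t + size (enc B (f a)) , +-mono-≤ t≤ (size≤μ B (f a)) , record
  { final   = enc B (f a) ∷ nil ∷ []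
  ; steps   = t
  ; exec    = e
  ; output  = refl
  ; elapsed = refl
  }

Real⇒Computable : ∀ {d} {f : List ℕ → ℕ} → Real (listᴰ binᴰ) binᴰ f → Computable {d} (f ∘ Vec.toList)
Real⇒Computable r = program r , λ v → _ , proj₂ (proj₂ (Real⇒Computes r (Vec.toList v)))

-- The default 0 agrees with the head of `nil`, which is `nil`, the encoding of 0.
firstOr0 : List ℕ → ℕ
firstOr0 []      = 0
firstOr0 (n ∷ _) = n

headR : Real (listᴰ binᴰ) binᴰ firstOr0
headR = exprR (hd val) (λ { [] _ → refl ; (_ ∷ _) _ → refl })
  (poly-≤ (λ { [] → ≤-refl ; (n ∷ ns) → m≤n⇒m≤1+n (m≤m+n (μ binᴰ n) _) }) poly-μ)

numberR : ∀ {Γ} c → Real Γ unᴰ (λ _ → c)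
numberR zero    = zeroR
numberR (suc c) = sucR ∘R numberR c

powR : ∀ d → Real unᴰ unᴰ (_^ d)
powR zero    = numberR 1
powR (suc d) = ap₂ mulR idR (powR d)

onFirst : ∀ {f} → Real unᴰ unᴰ f → Real (listᴰ binᴰ) binᴰ (f ∘ firstOr0)
onFirst r = toBinaryR ∘R r ∘R toUnaryR ∘R headR

^-distribʳ-* : ∀ o m n → (m * n) ^ o ≡ m ^ o * n ^ o
^-distribʳ-* zero    m n = refl
^-distribʳ-* (suc o) m n = trans (cong (m * n *_) (^-distribʳ-* o m n))
  ([m*n]*[o*p]≡[m*o]*[n*p] m n (m ^ o) (n ^ o))

timeBound : ℕ → ℕ → ℕ
timeBound d k = (3 + 4 * k) ^ d

timeBoundR : ∀ d → Real unᴰ unᴰ (timeBound d)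
timeBoundR d = powR d ∘R ap₂ addR (numberR 3) (ap₂ mulR (numberR 4) idR)

parameterBoundR : Real unᴰ unᴰ (λ k → k + k * k)
parameterBoundR = ap₂ addR idR (ap₂ mulR idR idR)

time-poly : Poly inputᴰ (λ a → cost reduceR a + μ outputᴰ (reduce a))
time-poly = poly-+ (cost-poly reduceR) (growth reduceR)

-- The measure counts `k` by its value, whereas the encoding holds only its binary digits. The
-- difference is absorbed by a factor that depends on the parameter alone.
input-measure : ∀ {n} (G : Graph n) k →
                suc (μ inputᴰ (matrix G , k)) ≤ (3 + 4 * k) * size (encodeGraph G ∙ encodeℕ k)
input-measure G k = begin
  suc (suc (μ (listᴰ (listᴰ boolᴰ)) (matrix G) + suc (4 * k)))
    ≡⟨ cong (λ m → suc (suc (m + suc (4 * k))))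
         (trans (μ≡size (μ≡size (λ _ → refl)) (matrix G)) (cong size (encode-matrix G))) ⟩
  suc (suc (s + suc (4 * k)))
    ≤⟨ m≤m+n _ (3 + 2 * s + 4 * k * (1 + s)) ⟩
  suc (suc (s + suc (4 * k))) + (3 + 2 * s + 4 * k * (1 + s))
    ≡⟨ expand s k ⟩
  (3 + 4 * k) * suc (s + 1)
    ≤⟨ *-monoʳ-≤ (3 + 4 * k) (s≤s (+-monoʳ-≤ s (1≤size (encodeℕ k)))) ⟩
  (3 + 4 * k) * suc (s + size (encodeℕ k))
    ∎
  where
  open ≤-Reasoning
  s = size (encodeGraph G)
  expand : ∀ s k → suc (suc (s + suc (4 * k))) + (3 + 2 * s + 4 * k * (1 + s)) ≡ (3 + 4 * k) * suc (s + 1)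
  expand = solve-∀

theorem13 : W[1]-Hard k-SeparatingVertices-CoBalanced3Track
theorem13 = record
  { program      = program reduceR
  ; g            = timeBound d ∘ firstOr0 ∘ Vec.toList
  ; g-computable = Real⇒Computable (onFirst (timeBoundR d))
  ; exponent     = d
  -- The sum bounds both new parameters, `k` and `k * k`.
  ; h            = (λ k → k + k * k) ∘ firstOr0 ∘ Vec.toList
  ; h-computable = Real⇒Computable (onFirst parameterBoundR)
  ; image        = λ (_ , G , k) → image G k
  ; time         = λ (_ , G , k) → time G k
  ; computes     = λ (_ , G , k) → computes G k
  ; time-bound   = λ (_ , G , k) → time≤ G k
  ; equivalent   = λ (_ , G , k) → mk⇔ (Reduction.clique⇒separation G k) (Reduction.separation⇒clique G k)
  ; param-bound  = λ (_ , _ , k) → m≤m+n k _ ∷ m≤n+m _ k ∷ []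
  }
  where
  d : ℕ
  d = degree time-poly

  time : ∀ {n} → Graph n → ℕ → ℕ
  time G k = proj₁ (Real⇒Computes reduceR (matrix G , k))

  computes : ∀ {n} (G : Graph n) k →
             Computes (program reduceR) (encodeGraph G ∙ encodeℕ k)
                      (ParamProblem.encode k-SeparatingVertices-CoBalanced3Track (image G k)) (time G k)
  computes G k = subst₂ (λ x y → Computes (program reduceR) x y (time G k))
    (cong (_∙ encodeℕ k) (encode-matrix G)) (encode-reduce G k)
    (proj₂ (proj₂ (Real⇒Computes reduceR (matrix G , k))))

  time≤ : ∀ {n} (G : Graph n) k →
          time G k ≤ timeBound d k * size (encodeGraph G ∙ encodeℕ k) ^ d
  time≤ G k = begin
    time G k
      ≤⟨ proj₁ (proj₂ (Real⇒Computes reduceR (matrix G , k))) ⟩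
    cost reduceR (matrix G , k) + μ outputᴰ (reduce (matrix G , k))
      ≤⟨ bound time-poly (matrix G , k) ⟩
    suc (μ inputᴰ (matrix G , k)) ^ d
      ≤⟨ ^-monoˡ-≤ d (input-measure G k) ⟩
    -- The power of the product splits into a function of the parameter and a fixed power of the
    -- input size.
    ((3 + 4 * k) * size (encodeGraph G ∙ encodeℕ k)) ^ d
      ≡⟨ ^-distribʳ-* d (3 + 4 * k) _ ⟩
    timeBound d k * size (encodeGraph G ∙ encodeℕ k) ^ d
      ∎
    where open ≤-Reasoning
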